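{- Let $\mathcal{GG}$ be the set of Göllnitz–Gordon partitions, that is, integer partitions $\lambda$ such that $\lambda_i-\lambda_{i+1}\ge 2$ for all $1\le i<\ell(\lambda)$, with strict inequality if either $\lambda_i$ or $\lambda_{i+1}$ is even. Let $\mathcal{G}$ be the set of Göllnitz partitions, that is, integer partitions $\lambda$ such that $\lambda_i-\lambda_{i+1}\ge 2$ for all $1\le i<\ell(\lambda)$, with strict inequality if either $\lambda_i$ or $\lambda_{i+1}$ is odd. Let $$f_{\mathcal{GG}}(x;q):=\sum_{\lambda\in\mathcal{GG}}x^{\ell(\lambda)}q^{|\lambda|},\qquad f_{\mathcal{G}}(x;q):=\sum_{\lambda\in\mathcal{G}}x^{\ell(\lambda)}q^{|\lambda|}.$$ Then $$f_{\mathcal{GG}}(x;q)=\sum_{k,m\ge 0}\frac{(-1)^k\,x^{m+2k}\,q^{m^2+4mk+6k^2}}{(q;q)_m\,(q^4;q^4)_k},$$ $$f_{\mathcal{G}}(x;q)=\sum_{k,m\ge 0}\frac{(-1)^k\,x^{m+2k}\,q^{m^2+4mk+6k^2-2k}}{(q;q)_m\,(q^4;q^4)_k}.$$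
   Context: For an integer partition $\lambda$ with (positive integer) parts $\lambda_1\ge\cdots\ge\lambda_\ell$, its size is $|\lambda|=\lambda_1+\cdots+\lambda_\ell$ and its length is $\ell(\lambda)=\ell$ (the number of parts); the empty partition is allowed, with size and length $0$. For an integer $n\ge 0$, $(a;q)_n=\prod_{k=0}^{n-1}(1-aq^k)$. The identities may be read as identities of formal power series in $q$ whose coefficients are polynomials in $x$ (equivalently, as identities of convergent series for complex $x$ and $|q|<1$). -}

module Defs where

open import Algebra.Bundles.Raw using (RawRing)
import Algebra.Definitions.RawSemiring as RawSemiringDefs
open import Data.Integer.Base as ℤ using (ℤ; 0ℤ; 1ℤ)
import Data.Integer.Properties as ℤ
open import Data.List.Base as List
  using (List; []; _∷_; [_]; map; length; upTo; concatMap; filter;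
         deduplicate; cartesianProduct; foldr)
open import Data.List.Membership.Propositional using (_∈_; _∉_; lose)
open import Data.List.Membership.Propositional.Properties
  using (∈-upTo⁺; ∈-map⁺; ∈-concatMap⁺; ∈-filter⁺; ∈-deduplicate⁺;
         ∈-cartesianProduct⁺; ∈-upTo⁻)
import Data.List.Properties as List
open import Data.List.Relation.Unary.All as All using (All; []; _∷_)
import Data.List.Relation.Unary.All.Properties as All
open import Data.List.Relation.Unary.Any using (here; there)
open import Data.List.Relation.Unary.Linked using (Linked; linked?)
open import Data.List.Relation.Unary.Unique.Propositional using (Unique)
import Data.List.Relation.Unary.Unique.Propositional.Properties as Unique
import Data.List.Relation.Unary.Unique.DecPropositional.Properties as UniqueDec
open import Data.Nat.Base
  using (ℕ; zero; suc; _+_; _*_; _∸_; _^_; _≤_; _<_; _≥_; z≤n; s≤s)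
open import Data.Nat.ListAction using (sum)
open import Data.Nat.Divisibility using (_∣_; _∣?_)
import Data.Nat.Properties as ℕ
open import Data.Product.Base using (_×_; _,_; proj₁; proj₂)
open import Data.Fin.Base using (toℕ)
open import Data.Sum.Base using (_⊎_; inj₁; inj₂)
open import Data.Vec.Base as Vec using (Vec; []; _∷_)
open import Function.Base using (_∘_)
open import Level using (0ℓ)
open import Relation.Binary.Core using (Rel)
open import Relation.Binary.Definitions using () renaming (Decidable to Decidable₂)
open import Relation.Binary.PropositionalEquality
  using (_≡_; refl; sym; trans; cong; cong₂; subst)
open import Relation.Nullary using (¬_; ¬?)
open import Relation.Nullary.Decidable using (_×-dec_; _⊎-dec_; _→-dec_)
open import Relation.Nullary.Negation using (contradiction)
open import Relation.Unary using (Pred; Decidable; U)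

------------------------------------------------------------------------
-- The polynomial ring ℤ[x]

-- Coefficient lists, constant term first; trailing zeros are allowed,
-- so equality is equality of all coefficients.

Poly : Set
Poly = List ℤ

coeff : Poly → ℕ → ℤ
coeff []      _       = 0ℤ
coeff (a ∷ _) zero    = a
coeff (_ ∷ p) (suc n) = coeff p n

infix 4 _≈ᵖ_

_≈ᵖ_ : Rel Poly 0ℓ
p ≈ᵖ r = ∀ n → coeff p n ≡ coeff r n

infixl 6 _+ᵖ_
infixl 7 _*ᵖ_
infix  8 -ᵖ_

0ᵖ 1ᵖ : Poly
0ᵖ = []
1ᵖ = [ 1ℤ ]

_+ᵖ_ : Poly → Poly → Poly
[]      +ᵖ r       = r
(a ∷ p) +ᵖ []      = a ∷ p
(a ∷ p) +ᵖ (b ∷ r) = a ℤ.+ b ∷ (p +ᵖ r)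

-ᵖ_ : Poly → Poly
-ᵖ_ = map (ℤ.-_)

-- (a + x p) r = a r + x (p r)
_*ᵖ_ : Poly → Poly → Poly
[]      *ᵖ r = []
(a ∷ p) *ᵖ r = map (a ℤ.*_) r +ᵖ (0ℤ ∷ p *ᵖ r)

sumᵖ : List Poly → Poly
sumᵖ = foldr _+ᵖ_ 0ᵖ

------------------------------------------------------------------------
-- The power series ring ℤ[x]⟦q⟧

-- f n is the coefficient of qⁿ.

Series : Set
Series = ℕ → Poly

infix 4 _≈_

_≈_ : Rel Series 0ℓ
f ≈ g = ∀ n → f n ≈ᵖ g n

const : Poly → Series
const p zero    = p
const p (suc _) = 0ᵖ

infixl 6 _+ˢ_ _-ˢ_
infixl 7 _*ˢ_ _/ˢ_
infix  8 -ˢ_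

0ˢ 1ˢ x q : Series
0ˢ = const 0ᵖ
1ˢ = const 1ᵖ
x  = const (0ℤ ∷ 1ℤ ∷ [])
q zero    = 0ᵖ
q (suc n) = 1ˢ n

_+ˢ_ : Series → Series → Series
(f +ˢ g) n = f n +ᵖ g n

-ˢ_ : Series → Series
(-ˢ f) n = -ᵖ f n

_-ˢ_ : Series → Series → Series
f -ˢ g = f +ˢ (-ˢ g)

_*ˢ_ : Series → Series → Series
(f *ˢ g) n = sumᵖ (map (λ i → f i *ᵖ g (n ∸ i)) (upTo (suc n)))

seriesRing : RawRing 0ℓ 0ℓ
seriesRing = record
  { Carrier = Series ; _≈_ = _≈_
  ; _+_ = _+ˢ_ ; _*_ = _*ˢ_ ; -_ = -ˢ_ ; 0# = 0ˢ ; 1# = 1ˢ }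

open RawSemiringDefs (RawRing.rawSemiring seriesRing) public
  using () renaming (_^_ to _^ˢ_)

-- When g has constant term 1, its inverse r is determined by r₀ = 1 and
-- rₙ₊₁ = - ∑_{i ≤ n} gᵢ₊₁ rₙ₋ᵢ.  The vector holds rₙ, rₙ₋₁, …, r₀.
-- Only such g are ever inverted; for other g the value is meaningless.

recipCoeffs : Series → (n : ℕ) → Vec Poly (suc n)
recipCoeffs g zero    = 1ᵖ ∷ []
recipCoeffs g (suc n) =
  let rs = recipCoeffs g n
  in (-ᵖ sumᵖ (Vec.toList (Vec.zipWith _*ᵖ_ (Vec.tabulate (g ∘ suc ∘ toℕ)) rs))) ∷ rs

recip : Series → Series
recip g n = Vec.head (recipCoeffs g n)

_/ˢ_ : Series → Series → Series
f /ˢ g = f *ˢ recip g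

-- qPochhammer a b n is (a; b)ₙ.
qPochhammer : Series → Series → ℕ → Series
qPochhammer a b zero    = 1ˢ
qPochhammer a b (suc n) = qPochhammer a b n *ˢ (1ˢ -ˢ a *ˢ b ^ˢ n)

------------------------------------------------------------------------
-- Infinite sums of formal power series

-- The family (a i), for i satisfying P, is summable when for every n only
-- finitely many a i have a nonzero coefficient of qⁿ.  The support may list
-- additional indices, whose coefficients vanish, so the sum below does not
-- depend (up to ≈) on the choice of support.

record Summable {I : Set} (P : Pred I 0ℓ) (a : I → Series) : Set where
  field
    support  : ℕ → List I
    unique   : ∀ n → Unique (support n)
    sound    : ∀ n → All P (support n)
    complete : ∀ n i → P i → i ∉ support n → a i n ≈ᵖ 0ᵖ

∑ : {I : Set} (P : Pred I 0ℓ) (a : I → Series) → Summable P a → Series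
∑ P a s n = sumᵖ (map (λ i → a i n) (Summable.support s n))

------------------------------------------------------------------------
-- Partitions

IsPartition : Pred (List ℕ) 0ℓ
IsPartition μ = All (0 <_) μ × Linked _≥_ μ

GGGap GGap : Rel ℕ 0ℓ
GGGap a b = 2 ≤ a ∸ b × (2 ∣ a ⊎ 2 ∣ b → 2 < a ∸ b)
GGap  a b = 2 ≤ a ∸ b × (¬ 2 ∣ a ⊎ ¬ 2 ∣ b → 2 < a ∸ b)

GöllnitzGordon Göllnitz : Pred (List ℕ) 0ℓ
GöllnitzGordon μ = IsPartition μ × Linked GGGap μ
Göllnitz       μ = IsPartition μ × Linked GGap μ

weight : List ℕ → Series
weight μ = x ^ˢ length μ *ˢ q ^ˢ sum μ

------------------------------------------------------------------------
-- Summability of the families involved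

module Vanishing where

  coeff-+ : ∀ p r n → coeff (p +ᵖ r) n ≡ coeff p n ℤ.+ coeff r n
  coeff-+ []      r       n       = sym (ℤ.+-identityˡ _)
  coeff-+ (a ∷ p) []      n       = sym (ℤ.+-identityʳ _)
  coeff-+ (a ∷ p) (b ∷ r) zero    = refl
  coeff-+ (a ∷ p) (b ∷ r) (suc n) = coeff-+ p r n

  coeff-scale : ∀ a p n → coeff (map (a ℤ.*_) p) n ≡ a ℤ.* coeff p n
  coeff-scale a []      n       = sym (ℤ.*-zeroʳ a)
  coeff-scale a (b ∷ p) zero    = refl
  coeff-scale a (b ∷ p) (suc n) = coeff-scale a p n

  +-zero : ∀ p r → p ≈ᵖ 0ᵖ → r ≈ᵖ 0ᵖ → p +ᵖ r ≈ᵖ 0ᵖ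
  +-zero p r p≈0 r≈0 n = trans (coeff-+ p r n) (cong₂ ℤ._+_ (p≈0 n) (r≈0 n))

  shift-zero : ∀ p → p ≈ᵖ 0ᵖ → 0ℤ ∷ p ≈ᵖ 0ᵖ
  shift-zero p p≈0 zero    = refl
  shift-zero p p≈0 (suc n) = p≈0 n

  *-zeroˡ : ∀ p r → p ≈ᵖ 0ᵖ → p *ᵖ r ≈ᵖ 0ᵖ
  *-zeroˡ []      r p≈0 = λ _ → refl
  *-zeroˡ (a ∷ p) r p≈0 = +-zero (map (a ℤ.*_) r) _
    (λ n → trans (coeff-scale a r n)
             (trans (cong (ℤ._* coeff r n) (p≈0 0)) (ℤ.*-zeroˡ (coeff r n))))
    (shift-zero _ (*-zeroˡ p r (p≈0 ∘ suc)))

  *-zeroʳ : ∀ p r → r ≈ᵖ 0ᵖ → p *ᵖ r ≈ᵖ 0ᵖ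
  *-zeroʳ []      r r≈0 = λ _ → refl
  *-zeroʳ (a ∷ p) r r≈0 = +-zero (map (a ℤ.*_) r) _
    (λ n → trans (coeff-scale a r n)
             (trans (cong (a ℤ.*_) (r≈0 n)) (ℤ.*-zeroʳ a)))
    (shift-zero _ (*-zeroʳ p r r≈0))

  sum-zero : ∀ {A : Set} (t : A → Poly) is → (∀ i → i ∈ is → t i ≈ᵖ 0ᵖ) →
             sumᵖ (map t is) ≈ᵖ 0ᵖ
  sum-zero t []       t≈0 = λ _ → refl
  sum-zero t (i ∷ is) t≈0 = +-zero (t i) _ (t≈0 i (here refl))
    (sum-zero t is (λ j j∈is → t≈0 j (there j∈is)))

  Order≥ : ℕ → Series → Set
  Order≥ e f = ∀ n → n < e → f n ≈ᵖ 0ᵖ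

  order-≥0 : ∀ f → Order≥ 0 f
  order-≥0 f n ()

  order-* : ∀ d e f g → Order≥ d f → Order≥ e g → Order≥ (d + e) (f *ˢ g)
  order-* d e f g df eg n n<d+e = sum-zero (λ i → f i *ᵖ g (n ∸ i)) (upTo (suc n)) term
    where
    term : ∀ i → i ∈ upTo (suc n) → f i *ᵖ g (n ∸ i) ≈ᵖ 0ᵖ
    term i i∈ with ℕ.<-≤-connex i d
    ... | inj₁ i<d = *-zeroˡ (f i) _ (df i i<d)
    ... | inj₂ d≤i = *-zeroʳ (f i) _ (eg (n ∸ i) (begin-strict
      n ∸ i      ≤⟨ ℕ.∸-monoʳ-≤ n d≤i ⟩
      n ∸ d      <⟨ ℕ.∸-monoˡ-< n<d+e (ℕ.≤-trans d≤i (ℕ.≤-pred (∈-upTo⁻ i∈))) ⟩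
      d + e ∸ d  ≡⟨ ℕ.m+n∸m≡n d e ⟩
      e          ∎))
      where open ℕ.≤-Reasoning

  order-q^ : ∀ e → Order≥ e (q ^ˢ e)
  order-q^ zero    = order-≥0 (q ^ˢ 0)
  order-q^ (suc e) = order-* 1 e q (q ^ˢ e) order-q (order-q^ e)
    where
    order-q : Order≥ 1 q
    order-q zero    _        _ = refl
    order-q (suc _) (s≤s ())

  order-fq^ : ∀ f e → Order≥ e (f *ˢ q ^ˢ e)
  order-fq^ f e = order-* 0 e f (q ^ˢ e) (order-≥0 f) (order-q^ e)

  -- All lists of positive integers with sum at most b, provided b ≤ fuel.
  lists : (fuel b : ℕ) → List (List ℕ)
  lists zero       b = [ [] ]
  lists (suc fuel) b =
    [] ∷ concatMap (λ a → map (suc a ∷_) (lists fuel (b ∸ suc a))) (upTo b)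

  ∈-lists : ∀ fuel b μ → All (0 <_) μ → sum μ ≤ b → b ≤ fuel → μ ∈ lists fuel b
  ∈-lists zero       b []          _        _   _   = here refl
  ∈-lists zero       b (zero ∷ _)  (() ∷ _) _   _
  ∈-lists zero       b (suc a ∷ μ) _        s≤b b≤0 =
    contradiction (ℕ.≤-trans s≤b b≤0) λ ()
  ∈-lists (suc fuel) b []          _        _   _   = here refl
  ∈-lists (suc fuel) b (suc a ∷ μ) (_ ∷ μ>0) s≤b b≤f = there
    (∈-concatMap⁺ (λ a → map (suc a ∷_) (lists fuel (b ∸ suc a)))
      (lose (∈-upTo⁺ (ℕ.m+n≤o⇒m≤o (suc a) s≤b))
        (∈-map⁺ (suc a ∷_) (∈-lists fuel (b ∸ suc a) μ μ>0
          (ℕ.m+n≤o⇒m≤o∸n (sum μ) (subst (_≤ b) (ℕ.+-comm (suc a) (sum μ)) s≤b))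
          (ℕ.≤-trans (ℕ.∸-monoˡ-≤ (suc a) b≤f) (ℕ.m∸n≤m fuel a))))))

  weights-summable : {P : Pred (List ℕ) 0ℓ} → Decidable P →
                     (∀ μ → P μ → All (0 <_) μ) → Summable P weight
  weights-summable {P} P? positive = record
    { support  = support
    ; unique   = λ n → Unique.filter⁺ P? (UniqueDec.deduplicate-! (List.≡-dec ℕ._≟_) (lists n n))
    ; sound    = λ n → All.all-filter P? (candidates n)
    ; complete = complete
    }
    where
    candidates support : ℕ → List (List ℕ)
    candidates n = deduplicate (List.≡-dec ℕ._≟_) (lists n n)
    support n = filter P? (candidates n)

    complete : ∀ n μ → P μ → μ ∉ support n → weight μ n ≈ᵖ 0ᵖ
    complete n μ Pμ μ∉ with ℕ.<-≤-connex n (sum μ)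
    ... | inj₁ n<s = order-fq^ (x ^ˢ length μ) (sum μ) n n<s
    ... | inj₂ s≤n = contradiction
      (∈-filter⁺ P? (∈-deduplicate⁺ (List.≡-dec ℕ._≟_)
        (∈-lists n n μ (positive μ Pμ) s≤n ℕ.≤-refl)) Pμ) μ∉

  isPartition? : Decidable IsPartition
  isPartition? μ = All.all? (0 ℕ.<?_) μ ×-dec linked? ℕ._≥?_ μ

  ggGap? : Decidable₂ GGGap
  ggGap? a b = 2 ℕ.≤? a ∸ b ×-dec ((2 ∣? a ⊎-dec 2 ∣? b) →-dec 2 ℕ.<? a ∸ b)

  gGap? : Decidable₂ GGap
  gGap? a b = 2 ℕ.≤? a ∸ b ×-dec ((¬? (2 ∣? a) ⊎-dec ¬? (2 ∣? b)) →-dec 2 ℕ.<? a ∸ b)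

  m≤m² : ∀ m → m ≤ m ^ 2
  m≤m² zero    = z≤n
  m≤m² (suc m) = ℕ.m≤m*n (suc m) (suc m ^ 1)

open Vanishing

GöllnitzGordon-summable : Summable GöllnitzGordon weight
GöllnitzGordon-summable =
  weights-summable (λ μ → isPartition? μ ×-dec linked? ggGap? μ) (λ _ → proj₁ ∘ proj₁)

Göllnitz-summable : Summable Göllnitz weight
Göllnitz-summable =
  weights-summable (λ μ → isPartition? μ ×-dec linked? gGap? μ) (λ _ → proj₁ ∘ proj₁)

fGG fG : Series
fGG = ∑ GöllnitzGordon weight GöllnitzGordon-summable
fG  = ∑ Göllnitz weight Göllnitz-summable

-- Truncated subtraction is harmless in the second exponent, as 2k ≤ 6k².

exponentGG exponentG : ℕ → ℕ → ℕ
exponentGG k m = m ^ 2 + 4 * m * k + 6 * k ^ 2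
exponentG  k m = m ^ 2 + 4 * m * k + 6 * k ^ 2 ∸ 2 * k

doubleSumTerm : (exponent : ℕ → ℕ → ℕ) → ℕ × ℕ → Series
doubleSumTerm exponent (k , m) =
  ((-ˢ 1ˢ) ^ˢ k *ˢ x ^ˢ (m + 2 * k) *ˢ q ^ˢ exponent k m)
    /ˢ (qPochhammer q q m *ˢ qPochhammer (q ^ˢ 4) (q ^ˢ 4) k)

module DoubleSum where

  doubleSum-summable : (e : ℕ → ℕ → ℕ) →
                       (∀ k m → k ≤ e k m) → (∀ k m → m ≤ e k m) →
                       Summable U (doubleSumTerm e)
  doubleSum-summable e k≤e m≤e = record
    { support  = support
    ; unique   = λ n → Unique.cartesianProduct⁺ (Unique.upTo⁺ (suc n)) (Unique.upTo⁺ (suc n))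
    ; sound    = λ n → All.universal (λ _ → _) (support n)
    ; complete = complete
    }
    where
    support : ℕ → List (ℕ × ℕ)
    support n = cartesianProduct (upTo (suc n)) (upTo (suc n))

    vanish : ∀ n k m → n < e k m → doubleSumTerm e (k , m) n ≈ᵖ 0ᵖ
    vanish n k m n<e =
      order-* (e k m) 0 (c *ˢ q ^ˢ e k m) (recip d) (order-fq^ c (e k m)) (order-≥0 (recip d))
        n (subst (n <_) (sym (ℕ.+-identityʳ (e k m))) n<e)
      where
      c d : Series
      c = (-ˢ 1ˢ) ^ˢ k *ˢ x ^ˢ (m + 2 * k)
      d = qPochhammer q q m *ˢ qPochhammer (q ^ˢ 4) (q ^ˢ 4) k

    complete : ∀ n i → U i → i ∉ support n → doubleSumTerm e i n ≈ᵖ 0ᵖ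
    complete n (k , m) _ i∉ with ℕ.<-≤-connex n (e k m)
    ... | inj₁ n<e = vanish n k m n<e
    ... | inj₂ e≤n = contradiction
      (∈-cartesianProduct⁺ (∈-upTo⁺ (s≤s (ℕ.≤-trans (k≤e k m) e≤n)))
                           (∈-upTo⁺ (s≤s (ℕ.≤-trans (m≤e k m) e≤n)))) i∉

  m²+k≤eG : ∀ k m → m ^ 2 + k ≤ exponentG k m
  m²+k≤eG k m = ℕ.m+n≤o⇒m≤o∸n (m ^ 2 + k) (begin
    m ^ 2 + k + 2 * k              ≡⟨ ℕ.+-assoc (m ^ 2) k (2 * k) ⟩
    m ^ 2 + 3 * k                  ≤⟨ ℕ.+-mono-≤ (ℕ.m≤m+n (m ^ 2) (4 * m * k)) (ℕ.*-mono-≤ 3≤6 (m≤m² k)) ⟩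
    m ^ 2 + 4 * m * k + 6 * k ^ 2  ∎)
    where
    open ℕ.≤-Reasoning
    3≤6 : 3 ≤ 6
    3≤6 = s≤s (s≤s (s≤s z≤n))

  k≤eG : ∀ k m → k ≤ exponentG k m
  k≤eG k m = ℕ.≤-trans (ℕ.m≤n+m k (m ^ 2)) (m²+k≤eG k m)

  m≤eG : ∀ k m → m ≤ exponentG k m
  m≤eG k m = ℕ.≤-trans (m≤m² m) (ℕ.≤-trans (ℕ.m≤m+n (m ^ 2) k) (m²+k≤eG k m))

  eG≤eGG : ∀ k m → exponentG k m ≤ exponentGG k m
  eG≤eGG k m = ℕ.m∸n≤m (exponentGG k m) (2 * k)

open DoubleSum

doubleSumGG-summable : Summable U (doubleSumTerm exponentGG)
doubleSumGG-summable = doubleSum-summable exponentGG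
  (λ k m → ℕ.≤-trans (k≤eG k m) (eG≤eGG k m))
  (λ k m → ℕ.≤-trans (m≤eG k m) (eG≤eGG k m))

doubleSumG-summable : Summable U (doubleSumTerm exponentG)
doubleSumG-summable = doubleSum-summable exponentG k≤eG m≤eG

{-# OPTIONS --safe #-}

-- For a fixed number n of parts, let g_n be the generating function in q of the Göllnitz–Gordon
-- partitions.  If the smallest part is at least 3, subtract 2 from every part; if it is 1 or 2,
-- delete it and subtract 2 or 4 from the others.  This gives
--   g_{n+1} = q^{2n+2} g_{n+1} + (q^{2n+1} + q^{4n+2}) g_n,
-- which determines all g_n from g_0 = 1.  Lowering the parts of a Göllnitz partition by 1, or
-- deleting a part 1 and lowering the other parts by 3, expresses its generating function through
-- g_{n+1} and g_n.
--
-- On the other side, the coefficient of x^n in the first double sum is q^{n²} d_n, where d_n is the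
-- coefficient of z^n in H(z) = (z² q²; q⁴)_∞ / (z; q)_∞.  The product satisfies
-- (1 − z) H(z) = (1 + z q) H(z q²), and the coefficientwise form of this gives the same recurrence.
-- The second double sum is obtained in the same way from (z² q²; q⁴)_∞ / (z q; q)_∞.

module Submission where

open import Defs
open import Data.Nat.Base using (ℕ; _+_; _*_; _∸_; _^_)
open import Data.Product.Base using (_×_; _,_)
open import Relation.Unary using (U)

open import Algebra.Bundles using (CommutativeMonoid; CommutativeRing; CommutativeSemiring)
open import Algebra.Bundles.Raw using (RawRing)
import Algebra.Construct.Pointwise as Pointwise
import Algebra.Morphism.RingMonomorphism as RingMonomorphism
open import Algebra.Morphism.Structures using (IsRingMonomorphism)
import Algebra.Properties.CommutativeSemigroup as CommutativeSemigroupProperties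
import Algebra.Properties.Group as GroupProperties
import Algebra.Properties.Ring as RingProperties
import Algebra.Properties.Semiring.Exp as Exponentiation
import Algebra.Solver.Ring.NaturalCoefficients.Default as SemiringSolver
open import Data.Bool.Base using (true; false; if_then_else_)
open import Data.Fin.Base using (toℕ)
open import Data.Integer.Base as ℤ using (ℤ)
import Data.Integer.Properties as ℤ
open import Data.List.Base
  using (List; []; _∷_; [_]; _++_; _∷ʳ_; _∷ʳ′_; applyUpTo; filter; foldr; initLast; length; map; upTo)
open import Data.List.Extrema.Nat using (max; xs≤max)
import Data.List.Membership.DecPropositional as DecMembership
open import Data.List.Membership.Propositional using (_∈_; _∉_)
open import Data.List.Membership.Propositional.Properties
  using (∈-++⁺ˡ; ∈-++⁺ʳ; ∈-++⁻; ∈-deduplicate⁺; ∈-filter⁺; ∈-filter⁻; ∈-map⁺; ∈-map⁻; ∈-upTo⁺)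
open import Data.List.Membership.Propositional.Properties.WithK using (unique∧set⇒bag)
import Data.List.Properties as List
open import Data.List.Relation.Binary.BagAndSetEquality using (∼bag⇒↭)
open import Data.List.Relation.Binary.Permutation.Propositional as Perm using (_↭_)
open import Data.List.Relation.Unary.All as All using (All; []; _∷_)
import Data.List.Relation.Unary.All.Properties as All
open import Data.List.Relation.Unary.AllPairs as AllPairs using (AllPairs; []; _∷_)
import Data.List.Relation.Unary.AllPairs.Properties as AllPairs
open import Data.List.Relation.Unary.Any using (here; there)
open import Data.List.Relation.Unary.Linked using (Linked; linked?)
import Data.List.Relation.Unary.Linked.Properties as Linked
open import Data.List.Relation.Unary.Unique.Propositional using (Unique)
import Data.List.Relation.Unary.Unique.Propositional.Properties as Unique
open import Data.Nat.Base using (zero; suc; _≤_; _<_; z≤n; s≤s; z<s)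
open import Data.Nat.Divisibility using (_∣_; _∣?_; _∣0; ∣-refl; ∣m∣n⇒∣m+n; ∣m+n∣m⇒∣n)
open import Data.Nat.ListAction using (sum)
open import Data.Nat.ListAction.Properties using (sum-++)
import Data.Nat.Properties as ℕ
open import Data.Nat.Tactic.RingSolver using (solve-∀)
open import Data.Product.Base using (proj₁; proj₂; ∃; map₁)
open import Data.Product.Properties using (≡-dec)
open import Data.Sum.Base as Sum using (_⊎_; inj₁; inj₂)
import Data.Vec.Base as Vec
open import Function.Base using (_∘_; id; case_of_)
open import Function.Bundles using (mk⇔)
open import Function.Definitions using (Injective)
open import Level using (0ℓ)
open import Relation.Binary.Core using (Rel)
open import Relation.Binary.Definitions using (DecidableEquality; Transitive)
open import Relation.Binary.PropositionalEquality as ≡ using (_≡_; _≢_)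
import Relation.Binary.Reasoning.Setoid as SetoidReasoning
open import Relation.Nullary using (¬_; Dec; yes; no; does; contradiction)
open import Relation.Nullary.Decidable using (_×-dec_; dec-true; dec-false; from-no)
open import Relation.Unary using (Pred; Decidable; _∪_)

-- With n = m + 2k the exponent m² + 4mk + 6k² equals n² + 2k², and by Euler's identities 1/(q;q)_m
-- and (-1)^k q^(2k²)/(q⁴;q⁴)_k are the coefficients of 1/(z;q)_∞ and (z²q²;q⁴)_∞; this is where H
-- comes from. In the second sum n² - 2k = n(n-1) + m, and the extra q^m replaces z by zq in
-- 1/(z;q)_∞. The infinite products are never formed: each enters only through a first-order
-- recurrence of its coefficients. The factor 1 + zq arises as (1 - z²q²)/(1 - zq), and the division
-- by 1 - zq becomes an induction on the index of the coefficient. Lowering parts by 2 or 4 keeps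
-- parities and hence the gap condition; lowering by 1 or 3 exchanges even and odd, which turns
-- Göllnitz gaps into Göllnitz-Gordon gaps. The recurrence has g_{n+1} on both sides, yet determines
-- it, because a series equal to q^(2n+2) times itself vanishes. Each infinite sum is given by a
-- finite support for every power of q, so both are sorted by the exponent of x before they are
-- compared.

-- Power series rings

module PowerSeries {c ℓ} (R : CommutativeRing c ℓ) where

  open CommutativeRing R renaming
    (Carrier to A; _≈_ to _∼_; _+_ to _⊕_; _*_ to _⊛_; -_ to ⊖_; 0# to 𝟎; 1# to 𝟏)
  open CommutativeSemigroupProperties +-commutativeSemigroup using (interchange; x∙yz≈y∙xz)
  open SetoidReasoning setoid

  infixl 7 _⋆_

  -- The Cauchy product, by recursion that splits off the first coefficient of the left factor; the
  -- ring laws then follow by induction on the degree. It serves twice: for polynomials over ℤ and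
  -- for power series over ℤ[x].
  _⋆_ : (ℕ → A) → (ℕ → A) → ℕ → A
  (f ⋆ g) zero    = f 0 ⊛ g 0
  (f ⋆ g) (suc n) = f 0 ⊛ g (suc n) ⊕ (f ∘ suc ⋆ g) n

  one : ℕ → A
  one zero    = 𝟏
  one (suc _) = 𝟎

  ⋆-cong : ∀ {f f′ g g′} → (∀ n → f n ∼ f′ n) → (∀ n → g n ∼ g′ n) →
           ∀ n → (f ⋆ g) n ∼ (f′ ⋆ g′) n
  ⋆-cong f∼ g∼ zero    = *-cong (f∼ 0) (g∼ 0)
  ⋆-cong f∼ g∼ (suc n) = +-cong (*-cong (f∼ 0) (g∼ (suc n))) (⋆-cong (f∼ ∘ suc) g∼ n)

  ⋆-distribʳ : ∀ h f g n → ((λ i → f i ⊕ g i) ⋆ h) n ∼ (f ⋆ h) n ⊕ (g ⋆ h) n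
  ⋆-distribʳ h f g zero    = distribʳ _ _ _
  ⋆-distribʳ h f g (suc n) =
    trans (+-cong (distribʳ _ _ _) (⋆-distribʳ h (f ∘ suc) (g ∘ suc) n)) (interchange _ _ _ _)

  ⋆-scale : ∀ a f g n → ((λ i → a ⊛ f i) ⋆ g) n ∼ a ⊛ (f ⋆ g) n
  ⋆-scale a f g zero    = *-assoc _ _ _
  ⋆-scale a f g (suc n) =
    trans (+-cong (*-assoc _ _ _) (⋆-scale a (f ∘ suc) g n)) (sym (distribˡ _ _ _))

  -- The mirror image of the defining recursion, splitting off the first coefficient of the right
  -- factor; commutativity rests on it.
  ⋆-sucʳ : ∀ f g n → (f ⋆ g) (suc n) ∼ f (suc n) ⊛ g 0 ⊕ (f ⋆ g ∘ suc) n
  ⋆-sucʳ f g zero    = +-comm _ _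
  ⋆-sucʳ f g (suc n) = begin
    f 0 ⊛ g (suc (suc n)) ⊕ (f ∘ suc ⋆ g) (suc n)
      ≈⟨ +-congˡ (⋆-sucʳ (f ∘ suc) g n) ⟩
    f 0 ⊛ g (suc (suc n)) ⊕ (f (suc (suc n)) ⊛ g 0 ⊕ (f ∘ suc ⋆ g ∘ suc) n)
      ≈⟨ x∙yz≈y∙xz _ _ _ ⟩
    f (suc (suc n)) ⊛ g 0 ⊕ (f ⋆ g ∘ suc) (suc n)
      ∎

  ⋆-comm : ∀ f g n → (f ⋆ g) n ∼ (g ⋆ f) n
  ⋆-comm f g zero    = *-comm _ _
  ⋆-comm f g (suc n) =
    trans (+-cong (*-comm _ _) (⋆-comm (f ∘ suc) g n)) (sym (⋆-sucʳ g f n))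

  ⋆-assoc : ∀ f g h n → ((f ⋆ g) ⋆ h) n ∼ (f ⋆ (g ⋆ h)) n
  ⋆-assoc f g h zero    = *-assoc _ _ _
  ⋆-assoc f g h (suc n) = begin
    (f 0 ⊛ g 0) ⊛ h (suc n) ⊕ ((f ⋆ g) ∘ suc ⋆ h) n
      ≈⟨ +-congˡ (⋆-distribʳ h (λ i → f 0 ⊛ g (suc i)) (f ∘ suc ⋆ g) n) ⟩
    (f 0 ⊛ g 0) ⊛ h (suc n) ⊕ (((λ i → f 0 ⊛ g (suc i)) ⋆ h) n ⊕ ((f ∘ suc ⋆ g) ⋆ h) n)
      ≈⟨ +-cong (*-assoc _ _ _) (+-cong (⋆-scale (f 0) (g ∘ suc) h n) (⋆-assoc (f ∘ suc) g h n)) ⟩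
    f 0 ⊛ (g 0 ⊛ h (suc n)) ⊕ (f 0 ⊛ (g ∘ suc ⋆ h) n ⊕ (f ∘ suc ⋆ (g ⋆ h)) n)
      ≈⟨ +-assoc _ _ _ ⟨
    (f 0 ⊛ (g 0 ⊛ h (suc n)) ⊕ f 0 ⊛ (g ∘ suc ⋆ h) n) ⊕ (f ∘ suc ⋆ (g ⋆ h)) n
      ≈⟨ +-congʳ (distribˡ _ _ _) ⟨
    f 0 ⊛ (g ⋆ h) (suc n) ⊕ (f ∘ suc ⋆ (g ⋆ h)) n
      ∎

  ⋆-zeroˡ : ∀ f n → ((λ _ → 𝟎) ⋆ f) n ∼ 𝟎
  ⋆-zeroˡ f zero    = zeroˡ _
  ⋆-zeroˡ f (suc n) = trans (+-cong (zeroˡ _) (⋆-zeroˡ f n)) (+-identityˡ _)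

  ⋆-constantˡ : ∀ a f g → f 0 ∼ a → (∀ n → f (suc n) ∼ 𝟎) → ∀ n → (f ⋆ g) n ∼ a ⊛ g n
  ⋆-constantˡ a f g f₀ f₊ zero    = *-congʳ f₀
  ⋆-constantˡ a f g f₀ f₊ (suc n) =
    trans (+-cong (*-congʳ f₀) (trans (⋆-cong f₊ (λ _ → refl) n) (⋆-zeroˡ g n))) (+-identityʳ _)

  ⋆-identityˡ : ∀ f n → (one ⋆ f) n ∼ f n
  ⋆-identityˡ f n = trans (⋆-constantˡ 𝟏 one f refl (λ _ → refl) n) (*-identityˡ _)

  commutativeRing : CommutativeRing c ℓ
  commutativeRing = record
    { isCommutativeRing = record
      { isRing = record
        { +-isAbelianGroup = Pointwise.isAbelianGroup ℕ +-isAbelianGroup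
        ; *-cong     = ⋆-cong
        ; *-assoc    = ⋆-assoc
        ; *-identity = ⋆-identityˡ , λ f n → trans (⋆-comm f one n) (⋆-identityˡ f n)
        ; distrib    =
            (λ f g h n → trans (⋆-comm f _ n)
              (trans (⋆-distribʳ f g h n) (+-cong (⋆-comm g f n) (⋆-comm h f n))))
          , ⋆-distribʳ
        }
      ; *-comm = ⋆-comm
      }
    }

-- Finite sums

module FiniteSums {c ℓ} (M : CommutativeMonoid c ℓ) where

  open CommutativeMonoid M renaming (Carrier to C; _≈_ to _∼_)
  open CommutativeSemigroupProperties commutativeSemigroup using (interchange; x∙yz≈y∙xz)
  open SetoidReasoning setoid

  ⨁ : {I : Set} → List I → (I → C) → C
  ⨁ S F = foldr _∙_ ε (map F S)

  private variable
    I J : Set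

  ⨁-cong : ∀ (S : List I) {F G} → (∀ i → i ∈ S → F i ∼ G i) → ⨁ S F ∼ ⨁ S G
  ⨁-cong []      F≈G = refl
  ⨁-cong (i ∷ S) F≈G = ∙-cong (F≈G i (here ≡.refl)) (⨁-cong S (λ j → F≈G j ∘ there))

  ⨁-ε : (S : List I) → ⨁ S (λ _ → ε) ∼ ε
  ⨁-ε []      = refl
  ⨁-ε (i ∷ S) = trans (identityˡ _) (⨁-ε S)

  ⨁-∙ : ∀ (S : List I) F G → ⨁ S (λ i → F i ∙ G i) ∼ ⨁ S F ∙ ⨁ S G
  ⨁-∙ []      F G = sym (identityˡ ε)
  ⨁-∙ (i ∷ S) F G = trans (∙-congˡ (⨁-∙ S F G)) (interchange _ _ _ _)

  ⨁-map : ∀ (f : I → J) S F → ⨁ (map f S) F ≡ ⨁ S (F ∘ f)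
  ⨁-map f S F = ≡.cong (foldr _∙_ ε) (≡.sym (List.map-∘ S))

  ⨁-++ : ∀ (S T : List I) F → ⨁ (S ++ T) F ∼ ⨁ S F ∙ ⨁ T F
  ⨁-++ []      T F = sym (identityˡ _)
  ⨁-++ (i ∷ S) T F = trans (∙-congˡ (⨁-++ S T F)) (sym (assoc _ _ _))

  ⨁-swap : ∀ (S : List I) (T : List J) (F : I → J → C) →
           ⨁ S (λ i → ⨁ T (F i)) ∼ ⨁ T (λ j → ⨁ S (λ i → F i j))
  ⨁-swap []      T F = sym (⨁-ε T)
  ⨁-swap (i ∷ S) T F = trans (∙-congˡ (⨁-swap S T F)) (sym (⨁-∙ T (F i) _))

  ⨁-↭ : ∀ {S T : List I} F → S ↭ T → ⨁ S F ∼ ⨁ T F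
  ⨁-↭ F Perm.refl         = refl
  ⨁-↭ F (Perm.prep i p)   = ∙-congˡ (⨁-↭ F p)
  ⨁-↭ F (Perm.swap i j p) = trans (x∙yz≈y∙xz _ _ _) (∙-congˡ (∙-congˡ (⨁-↭ F p)))
  ⨁-↭ F (Perm.trans p r)  = trans (⨁-↭ F p) (⨁-↭ F r)

  ⨁-set : ∀ {S T : List I} F → Unique S → Unique T → (∀ i → i ∈ S → i ∈ T) → (∀ i → i ∈ T → i ∈ S) →
          ⨁ S F ∼ ⨁ T F
  ⨁-set F uS uT S⊆T T⊆S =
    ⨁-↭ F (∼bag⇒↭ (unique∧set⇒bag uS uT (λ {i} → mk⇔ (S⊆T i) (T⊆S i))))

  ⨁-indicator : {P : Pred I 0ℓ} (P? : Decidable P) → ∀ S F →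
                ⨁ (filter P? S) F ∼ ⨁ S (λ i → if does (P? i) then F i else ε)
  ⨁-indicator P? []      F = refl
  ⨁-indicator P? (i ∷ S) F with does (P? i)
  ... | true  = ∙-congˡ (⨁-indicator P? S F)
  ... | false = trans (⨁-indicator P? S F) (sym (identityˡ _))

  ⨁-filter : {P : Pred I 0ℓ} (P? : Decidable P) → ∀ S F →
             (∀ i → i ∈ S → ¬ P i → F i ∼ ε) → ⨁ (filter P? S) F ∼ ⨁ S F
  ⨁-filter {P = P} P? S F F≈ε = trans (⨁-indicator P? S F) (⨁-cong S λ i i∈S → select i i∈S (P? i))
    where
    select : ∀ i → i ∈ S → (d : Dec (P i)) → (if does d then F i else ε) ∼ F i
    select i i∈S (yes _) = refl
    select i i∈S (no ¬p) = sym (F≈ε i i∈S ¬p)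

  -- Both sums reduce to the common members of the two lists. This is how sums over different
  -- supports of one family are compared.
  ⨁-support : DecidableEquality I → ∀ {S T : List I} F → Unique S → Unique T →
              (∀ i → i ∈ S → i ∉ T → F i ∼ ε) → (∀ i → i ∈ T → i ∉ S → F i ∼ ε) →
              ⨁ S F ∼ ⨁ T F
  ⨁-support _≟_ {S} {T} F uS uT S∖T T∖S = begin
    ⨁ S F                   ≈⟨ ⨁-filter (_∈? T) S F S∖T ⟨
    ⨁ (filter (_∈? T) S) F  ≈⟨ ⨁-set F (Unique.filter⁺ (_∈? T) uS) (Unique.filter⁺ (_∈? S) uT)
                                 (swap S T) (swap T S) ⟩
    ⨁ (filter (_∈? S) T) F  ≈⟨ ⨁-filter (_∈? S) T F T∖S ⟩
    ⨁ T F                   ∎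
    where
    open DecMembership _≟_ using (_∈?_)
    swap : ∀ S T i → i ∈ filter (_∈? T) S → i ∈ filter (_∈? S) T
    swap S T i i∈ = case ∈-filter⁻ (_∈? T) i∈ of λ (i∈S , i∈T) → ∈-filter⁺ (_∈? S) i∈T i∈S

  -- After exchanging the two summations, each i contributes only at n = f i.
  ⨁-fibres : ∀ (f : I → ℕ) B S F → (∀ i → i ∈ S → B ≤ f i → F i ∼ ε) →
             ⨁ (upTo B) (λ n → ⨁ (filter (λ i → f i ℕ.≟ n) S) F) ∼ ⨁ S F
  ⨁-fibres f B S F F≈ε = begin
    ⨁ (upTo B) (λ n → ⨁ (filter (λ i → f i ℕ.≟ n) S) F)
      ≈⟨ ⨁-cong (upTo B) (λ n _ → ⨁-indicator (λ i → f i ℕ.≟ n) S F) ⟩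
    ⨁ (upTo B) (λ n → ⨁ S (λ i → if does (f i ℕ.≟ n) then F i else ε))
      ≈⟨ ⨁-swap (upTo B) S _ ⟩
    ⨁ S (λ i → ⨁ (upTo B) (λ n → if does (f i ℕ.≟ n) then F i else ε))
      ≈⟨ ⨁-cong S (λ i i∈S → ⨁-support ℕ._≟_ _ (Unique.upTo⁺ B) ([] ∷ [])
           (λ n _ n∉ → outside i n (λ fi≡n → n∉ (here (≡.sym fi≡n))))
           -- If f i is not below B, no fibre contains i; this is where F i has to vanish.
           (λ { n (here ≡.refl) n∉ → trans (inside i) (F≈ε i i∈S (ℕ.≮⇒≥ (n∉ ∘ ∈-upTo⁺))) })) ⟩
    ⨁ S (λ i → ⨁ [ f i ] (λ n → if does (f i ℕ.≟ n) then F i else ε))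
      ≈⟨ ⨁-cong S (λ i _ → trans (identityʳ _) (inside i)) ⟩
    ⨁ S F
      ∎
    where
    inside : ∀ i → (if does (f i ℕ.≟ f i) then F i else ε) ∼ F i
    inside i rewrite dec-true (f i ℕ.≟ f i) ≡.refl = refl
    outside : ∀ i n → f i ≢ n → (if does (f i ℕ.≟ n) then F i else ε) ∼ ε
    outside i n fi≢n rewrite dec-false (f i ℕ.≟ n) fi≢n = refl

-- The pairs (k , m) with m + 2 k = n.
antidiagonal : ℕ → List (ℕ × ℕ)
antidiagonal zero          = [ 0 , 0 ]
antidiagonal (suc zero)    = [ 0 , 1 ]
antidiagonal (suc (suc n)) = (0 , suc (suc n)) ∷ map (map₁ suc) (antidiagonal n)

∈-antidiagonal⁻ : ∀ n {k m} → (k , m) ∈ antidiagonal n → m + 2 * k ≡ n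
∈-antidiagonal⁻ zero          (here ≡.refl) = ≡.refl
∈-antidiagonal⁻ (suc zero)    (here ≡.refl) = ≡.refl
∈-antidiagonal⁻ (suc (suc n)) (here ≡.refl) = ℕ.+-identityʳ _
∈-antidiagonal⁻ (suc (suc n)) (there i∈) with ∈-map⁻ (map₁ suc) i∈
... | (k , m) , i∈′ , ≡.refl = ≡.trans (shift k m) (≡.cong (suc ∘ suc) (∈-antidiagonal⁻ n i∈′))
  where
  shift : ∀ k m → m + 2 * suc k ≡ suc (suc (m + 2 * k))
  shift = solve-∀

∈-antidiagonal⁺ : ∀ k m → (k , m) ∈ antidiagonal (m + 2 * k)
∈-antidiagonal⁺ zero m rewrite ℕ.+-identityʳ m with m
... | zero        = here ≡.refl
... | suc zero    = here ≡.refl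
... | suc (suc _) = here ≡.refl
∈-antidiagonal⁺ (suc k) m =
  ≡.subst (λ n → (suc k , m) ∈ antidiagonal n) (shift k m)
    (there (∈-map⁺ (map₁ suc) (∈-antidiagonal⁺ k m)))
  where
  shift : ∀ k m → suc (suc (m + 2 * k)) ≡ m + 2 * suc k
  shift = solve-∀

antidiagonal-unique : ∀ n → Unique (antidiagonal n)
antidiagonal-unique zero          = [] ∷ []
antidiagonal-unique (suc zero)    = [] ∷ []
antidiagonal-unique (suc (suc n)) =
  All.tabulate (λ i∈ eq → case ∈-map⁻ (map₁ suc) i∈ of λ { (_ , _ , ≡.refl) → case eq of λ () })
  ∷ Unique.map⁺ (λ { ≡.refl → ≡.refl }) (antidiagonal-unique n)

-- Sums over m + 2k = n and the functional equation of H

module DiagonalSums {c ℓ} (R : CommutativeSemiring c ℓ) where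

  open CommutativeSemiring R renaming
    (Carrier to A; _≈_ to _∼_; _+_ to _⊕_; _*_ to _⊛_; 0# to 𝟎; 1# to 𝟏)
  open FiniteSums +-commutativeMonoid public
  open Exponentiation semiring public
    using (^-homo-*; ^-congʳ; ^-assocʳ) renaming (_^_ to infixr 8 _↑_)
  open SemiringSolver R using (solve; _:+_; _:*_; _:=_; con)
  open SetoidReasoning setoid

  ⨁-scale : ∀ {I : Set} a S (F : I → A) → ⨁ S (λ i → a ⊛ F i) ∼ a ⊛ ⨁ S F
  ⨁-scale a []      F = sym (zeroʳ a)
  ⨁-scale a (i ∷ S) F = trans (+-congˡ (⨁-scale a S F)) (sym (distribˡ _ _ _))

  diagonalSum : (ℕ × ℕ → A) → ℕ → A
  diagonalSum u n = ⨁ (antidiagonal n) u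

  diagonalSum-suc² : ∀ u n → diagonalSum u (2 + n) ≡ u (0 , 2 + n) ⊕ diagonalSum (u ∘ map₁ suc) n
  diagonalSum-suc² u n = ≡.cong (u (0 , 2 + n) ⊕_) (⨁-map (map₁ suc) (antidiagonal n) u)

  diagonalSum-cong : ∀ {u v} n → (∀ k m → m + 2 * k ≡ n → u (k , m) ∼ v (k , m)) →
                     diagonalSum u n ∼ diagonalSum v n
  diagonalSum-cong n u≈v = ⨁-cong (antidiagonal n) λ (k , m) i∈ → u≈v k m (∈-antidiagonal⁻ n i∈)

  -- For the generating functions U, V, W in which (k , m) carries z^(m+2k), this is U = V + z W.
  -- The induction goes in steps of two, as `antidiagonal` does.
  diagonalSum-shift : ∀ u v w → (∀ k → u (k , 0) ∼ v (k , 0)) →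
            (∀ k m → u (k , suc m) ∼ v (k , suc m) ⊕ w (k , m)) →
            ∀ n → diagonalSum u (suc n) ∼ diagonalSum v (suc n) ⊕ diagonalSum w n
  diagonalSum-shift u v w u₀ u₊ zero = begin
    u (0 , 1) ⊕ 𝟎                        ≈⟨ +-congʳ (u₊ 0 0) ⟩
    (v (0 , 1) ⊕ w (0 , 0)) ⊕ 𝟎          ≈⟨ solve 2 (λ a b → (a :+ b) :+ con 0 := (a :+ con 0) :+ (b :+ con 0))
                                           refl _ _ ⟩
    (v (0 , 1) ⊕ 𝟎) ⊕ (w (0 , 0) ⊕ 𝟎)    ∎
  diagonalSum-shift u v w u₀ u₊ (suc zero) = begin
    u (0 , 2) ⊕ (u (1 , 0) ⊕ 𝟎)
      ≈⟨ +-cong (u₊ 0 1) (+-congʳ (u₀ 1)) ⟩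
    (v (0 , 2) ⊕ w (0 , 1)) ⊕ (v (1 , 0) ⊕ 𝟎)
      ≈⟨ solve 3 (λ a b c → (a :+ b) :+ (c :+ con 0) := (a :+ (c :+ con 0)) :+ (b :+ con 0)) refl _ _ _ ⟩
    (v (0 , 2) ⊕ (v (1 , 0) ⊕ 𝟎)) ⊕ (w (0 , 1) ⊕ 𝟎)
      ∎
  diagonalSum-shift u v w u₀ u₊ (suc (suc n)) = begin
    diagonalSum u (3 + n)
      ≡⟨ diagonalSum-suc² u (suc n) ⟩
    u (0 , 3 + n) ⊕ diagonalSum (u ∘ map₁ suc) (suc n)
      ≈⟨ +-cong (u₊ 0 (2 + n))
           (diagonalSum-shift (u ∘ map₁ suc) (v ∘ map₁ suc) (w ∘ map₁ suc) (u₀ ∘ suc) (u₊ ∘ suc) n) ⟩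
    (v (0 , 3 + n) ⊕ w (0 , 2 + n)) ⊕ (diagonalSum (v ∘ map₁ suc) (suc n) ⊕ diagonalSum (w ∘ map₁ suc) n)
      ≈⟨ solve 4 (λ a b c d → (a :+ b) :+ (c :+ d) := (a :+ c) :+ (b :+ d)) refl _ _ _ _ ⟩
    (v (0 , 3 + n) ⊕ diagonalSum (v ∘ map₁ suc) (suc n)) ⊕ (w (0 , 2 + n) ⊕ diagonalSum (w ∘ map₁ suc) n)
      ≡⟨ ≡.cong₂ _⊕_ (diagonalSum-suc² v (suc n)) (diagonalSum-suc² w n) ⟨
    diagonalSum v (3 + n) ⊕ diagonalSum w (2 + n)
      ∎

  -- a and b are the coefficient sequences of A(z) = 1 / (z; q)_∞ and B(z) = (z² q²; q⁴)_∞ (in powers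
  -- of z and of z²); their recurrences are written without subtraction.  Then dⱼ is the coefficient
  -- sequence of A(z qʲ) B(z).
  module _ (q : A) (a b : ℕ → A)
    (a-suc : ∀ m → a (suc m) ∼ a m ⊕ q ↑ suc m ⊛ a (suc m))
    (b-suc : ∀ k → b (suc k) ⊕ q ↑ (4 * k + 2) ⊛ b k ∼ q ↑ (4 * k + 4) ⊛ b (suc k))
    where

    d₀ d₁ d₂ : ℕ → A
    d₀ = diagonalSum (λ (k , m) → a m ⊛ b k)
    d₁ = diagonalSum (λ (k , m) → q ↑ m ⊛ a m ⊛ b k)
    d₂ = diagonalSum (λ (k , m) → q ↑ m ⊛ q ↑ m ⊛ a m ⊛ b k)

    -- The coefficients of A(z) = A(zq) + z A(z), multiplied by B(z).
    d₀-suc : ∀ n → d₀ (suc n) ∼ d₁ (suc n) ⊕ d₀ n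
    d₀-suc = diagonalSum-shift _ _ _ (λ k → *-congʳ (sym (*-identityˡ _)))
      (λ k m → trans (*-congʳ (trans (a-suc m) (+-comm _ _))) (distribʳ _ _ _))

    -- The same functional equation at zq: A(zq) = A(zq²) + zq A(zq), multiplied by B(z).
    d₁-suc : ∀ n → d₁ (suc n) ∼ d₂ (suc n) ⊕ q ⊛ d₁ n
    d₁-suc n = trans (diagonalSum-shift _ _ (λ (k , m) → q ⊛ (q ↑ m ⊛ a m ⊛ b k))
        (λ k → solve 2 (λ x y → con 1 :* x :* y := con 1 :* con 1 :* x :* y) refl _ _)
        (λ k m → step (b k) (a-suc m)) n)
      (+-congˡ (⨁-scale q (antidiagonal n) _))
      where
      step : ∀ {m} z → a (suc m) ∼ a m ⊕ q ↑ suc m ⊛ a (suc m) →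
             q ↑ suc m ⊛ a (suc m) ⊛ z ∼ q ↑ suc m ⊛ q ↑ suc m ⊛ a (suc m) ⊛ z ⊕ q ⊛ (q ↑ m ⊛ a m ⊛ z)
      step {m} z eq = begin
        q ↑ suc m ⊛ a (suc m) ⊛ z
          ≈⟨ *-congʳ (*-congˡ eq) ⟩
        q ↑ suc m ⊛ (a m ⊕ q ↑ suc m ⊛ a (suc m)) ⊛ z
          ≈⟨ solve 5 (λ q p x y z → q :* p :* (x :+ q :* p :* y) :* z :=
               q :* p :* (q :* p) :* y :* z :+ q :* (p :* x :* z)) refl q (q ↑ m) _ _ z ⟩
        q ↑ suc m ⊛ q ↑ suc m ⊛ a (suc m) ⊛ z ⊕ q ⊛ (q ↑ m ⊛ a m ⊛ z)
          ∎

    private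
      q^-weight : ∀ k m n → m + 2 * k ≡ n → q ↑ (2 * n + 4) ∼ q ↑ m ⊛ q ↑ m ⊛ q ↑ (4 * k + 4)
      q^-weight k m _ ≡.refl = begin
        q ↑ (2 * (m + 2 * k) + 4)          ≈⟨ ^-congʳ q (exponent k m) ⟩
        q ↑ (m + m + (4 * k + 4))          ≈⟨ ^-homo-* q (m + m) _ ⟩
        q ↑ (m + m) ⊛ q ↑ (4 * k + 4)      ≈⟨ *-congʳ (^-homo-* q m m) ⟩
        q ↑ m ⊛ q ↑ m ⊛ q ↑ (4 * k + 4)    ∎
        where
        exponent : ∀ k m → 2 * (m + 2 * k) + 4 ≡ m + m + (4 * k + 4)
        exponent = solve-∀

      q^-weight′ : ∀ k m n → m + 2 * k ≡ n → q ↑ (2 * n + 2) ∼ q ↑ m ⊛ q ↑ m ⊛ q ↑ (4 * k + 2)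
      q^-weight′ k m _ ≡.refl = begin
        q ↑ (2 * (m + 2 * k) + 2)          ≈⟨ ^-congʳ q (exponent k m) ⟩
        q ↑ (m + m + (4 * k + 2))          ≈⟨ ^-homo-* q (m + m) _ ⟩
        q ↑ (m + m) ⊛ q ↑ (4 * k + 2)      ≈⟨ *-congʳ (^-homo-* q m m) ⟩
        q ↑ m ⊛ q ↑ m ⊛ q ↑ (4 * k + 2)    ∎
        where
        exponent : ∀ k m → 2 * (m + 2 * k) + 2 ≡ m + m + (4 * k + 2)
        exponent = solve-∀

    -- Since B(z) = (1 - z²q²) B(zq²), the product A(zq²) B(z) equals (1 - z²q²) H(zq²); the
    -- coefficients of z^(n+2) are compared.
    d₂-suc² : ∀ n → d₂ (2 + n) ⊕ q ↑ (2 * n + 2) ⊛ d₀ n ∼ q ↑ (2 * n + 4) ⊛ d₀ (2 + n)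
    d₂-suc² n = begin
      d₂ (2 + n) ⊕ Q₂ ⊛ d₀ n
        ≡⟨ ≡.cong (_⊕ Q₂ ⊛ d₀ n) (diagonalSum-suc² _ n) ⟩
      (q ↑ (2 + n) ⊛ q ↑ (2 + n) ⊛ a (2 + n) ⊛ b 0 ⊕ diagonalSum v n) ⊕ Q₂ ⊛ d₀ n
        ≈⟨ +-assoc _ _ _ ⟩
      q ↑ (2 + n) ⊛ q ↑ (2 + n) ⊛ a (2 + n) ⊛ b 0 ⊕ (diagonalSum v n ⊕ Q₂ ⊛ d₀ n)
        ≈⟨ +-cong first rest ⟩
      Q₄ ⊛ (a (2 + n) ⊛ b 0) ⊕ Q₄ ⊛ diagonalSum w n
        ≈⟨ distribˡ _ _ _ ⟨
      Q₄ ⊛ (a (2 + n) ⊛ b 0 ⊕ diagonalSum w n)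
        ≡⟨ ≡.cong (Q₄ ⊛_) (diagonalSum-suc² _ n) ⟨
      Q₄ ⊛ d₀ (2 + n)
        ∎
      where
      Q₂ = q ↑ (2 * n + 2)
      Q₄ = q ↑ (2 * n + 4)
      v w : ℕ × ℕ → A
      v (k , m) = q ↑ m ⊛ q ↑ m ⊛ a m ⊛ b (suc k)
      w (k , m) = a m ⊛ b (suc k)

      exponent : ∀ n → 2 * n + 4 ≡ (2 + n) + (2 + n)
      exponent = solve-∀

      first : q ↑ (2 + n) ⊛ q ↑ (2 + n) ⊛ a (2 + n) ⊛ b 0 ∼ Q₄ ⊛ (a (2 + n) ⊛ b 0)
      first = trans (*-assoc _ _ _)
        (*-congʳ (sym (trans (^-congʳ q (exponent n)) (^-homo-* q (2 + n) (2 + n)))))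

      term : ∀ k m → m + 2 * k ≡ n → v (k , m) ⊕ Q₂ ⊛ (a m ⊛ b k) ∼ Q₄ ⊛ w (k , m)
      term k m eq = begin
        p ⊛ p ⊛ a m ⊛ b (suc k) ⊕ Q₂ ⊛ (a m ⊛ b k)
          ≈⟨ +-congˡ (*-congʳ (q^-weight′ k m n eq)) ⟩
        p ⊛ p ⊛ a m ⊛ b (suc k) ⊕ p ⊛ p ⊛ q ↑ (4 * k + 2) ⊛ (a m ⊛ b k)
          ≈⟨ solve 5 (λ p x y r z → p :* p :* x :* y :+ p :* p :* r :* (x :* z)
               := p :* p :* x :* (y :+ r :* z)) refl p _ _ _ _ ⟩
        p ⊛ p ⊛ a m ⊛ (b (suc k) ⊕ q ↑ (4 * k + 2) ⊛ b k)
          ≈⟨ *-congˡ (b-suc k) ⟩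
        p ⊛ p ⊛ a m ⊛ (q ↑ (4 * k + 4) ⊛ b (suc k))
          ≈⟨ solve 4 (λ p x r y → p :* p :* x :* (r :* y) := p :* p :* r :* (x :* y)) refl p _ _ _ ⟩
        p ⊛ p ⊛ q ↑ (4 * k + 4) ⊛ w (k , m)
          ≈⟨ *-congʳ (q^-weight k m n eq) ⟨
        Q₄ ⊛ w (k , m)
          ∎
        where p = q ↑ m

      rest : diagonalSum v n ⊕ Q₂ ⊛ d₀ n ∼ Q₄ ⊛ diagonalSum w n
      rest = begin
        diagonalSum v n ⊕ Q₂ ⊛ d₀ n
          ≈⟨ +-congˡ (⨁-scale Q₂ (antidiagonal n) _) ⟨
        diagonalSum v n ⊕ diagonalSum (λ (k , m) → Q₂ ⊛ (a m ⊛ b k)) n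
          ≈⟨ ⨁-∙ (antidiagonal n) v _ ⟨
        diagonalSum (λ (k , m) → v (k , m) ⊕ Q₂ ⊛ (a m ⊛ b k)) n
          ≈⟨ diagonalSum-cong n term ⟩
        diagonalSum (λ i → Q₄ ⊛ w i) n
          ≈⟨ ⨁-scale Q₄ (antidiagonal n) w ⟩
        Q₄ ⊛ diagonalSum w n
          ∎

    -- This is A(zq) B(z) = (1 + zq) H(zq²). Multiplied by 1 - zq, both sides become A(zq²) B(z);
    -- the induction on n carries out the cancellation of that factor.
    d₁-d₀ : ∀ n → d₁ (suc n) ∼ q ↑ (2 * n + 2) ⊛ d₀ (suc n) ⊕ q ↑ (2 * n + 1) ⊛ d₀ n
    d₁-d₀ zero = trans (d₁-suc 0) (solve 4 (λ q x y z →
        (q :* con 1 :* (q :* con 1) :* x :* y :+ con 0) :+ q :* (con 1 :* z :* y :+ con 0)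
          := q :* (q :* con 1) :* (x :* y :+ con 0) :+ q :* con 1 :* (z :* y :+ con 0))
      refl q (a 1) (b 0) (a 0))
    d₁-d₀ (suc n) = begin
      d₁ (2 + n)
        ≈⟨ d₁-suc (suc n) ⟩
      d₂ (2 + n) ⊕ q ⊛ d₁ (suc n)
        ≈⟨ +-congˡ (*-congˡ (d₁-d₀ n)) ⟩
      d₂ (2 + n) ⊕ q ⊛ (q ↑ (2 * n + 2) ⊛ d₀ (suc n) ⊕ q ↑ (2 * n + 1) ⊛ d₀ n)
        -- The last summand of the induction hypothesis joins `d₂`, so that `d₂-suc²` applies to the
        -- pair.
        ≈⟨ solve 6 (λ u q r y s z → u :+ q :* (r :* y :+ s :* z) := (u :+ q :* s :* z) :+ q :* r :* y)
             refl _ q _ _ _ _ ⟩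
      (d₂ (2 + n) ⊕ q ↑ suc (2 * n + 1) ⊛ d₀ n) ⊕ q ↑ suc (2 * n + 2) ⊛ d₀ (suc n)
        ≈⟨ +-cong (trans (+-congˡ (*-congʳ (^-congʳ q (exponent₂ n))))
                    (trans (d₂-suc² n) (*-congʳ (^-congʳ q (exponent₄ n)))))
                  (*-congʳ (^-congʳ q (exponent₃ n))) ⟩
      q ↑ (2 * suc n + 2) ⊛ d₀ (2 + n) ⊕ q ↑ (2 * suc n + 1) ⊛ d₀ (suc n)
        ∎
      where
      exponent₂ : ∀ n → suc (2 * n + 1) ≡ 2 * n + 2
      exponent₂ = solve-∀
      exponent₃ : ∀ n → suc (2 * n + 2) ≡ 2 * suc n + 1
      exponent₃ = solve-∀
      exponent₄ : ∀ n → 2 * n + 4 ≡ 2 * suc n + 2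
      exponent₄ = solve-∀

    d₀-recurrence : ∀ n → d₀ (suc n) ∼ q ↑ (2 * n + 2) ⊛ d₀ (suc n) ⊕ (q ↑ (2 * n + 1) ⊕ 𝟏) ⊛ d₀ n
    d₀-recurrence n = begin
      d₀ (suc n)
        ≈⟨ d₀-suc n ⟩
      d₁ (suc n) ⊕ d₀ n
        ≈⟨ +-congʳ (d₁-d₀ n) ⟩
      (q ↑ (2 * n + 2) ⊛ d₀ (suc n) ⊕ q ↑ (2 * n + 1) ⊛ d₀ n) ⊕ d₀ n
        ≈⟨ solve 3 (λ u r z → (u :+ r :* z) :+ z := u :+ (r :+ con 1) :* z) refl _ _ _ ⟩
      q ↑ (2 * n + 2) ⊛ d₀ (suc n) ⊕ (q ↑ (2 * n + 1) ⊕ 𝟏) ⊛ d₀ n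
        ∎

-- The recurrence for the double sums

-- Completing the square leaves 2k², free of m: q^(n²) leaves the diagonal sum, and the rest splits
-- into a factor in m and a factor in k.
exponentGG-square : ∀ k m n → m + 2 * k ≡ n → exponentGG k m ≡ n * n + 2 * (k * k)
exponentGG-square k m _ ≡.refl = expand k m
  where
  expand : ∀ k m → m * (m * 1) + 4 * m * k + 6 * (k * (k * 1)) ≡ (m + 2 * k) * (m + 2 * k) + 2 * (k * k)
  expand = solve-∀

-- At degree n + 1 one has (n+1)² - 2k = n(n+1) + m; the remaining q^m turns A(z) into A(zq).
exponentG-square : ∀ k m n → m + 2 * k ≡ suc n → exponentG k m ≡ n * suc n + m + 2 * (k * k)
exponentG-square k m n eq = begin
  exponentGG k m ∸ 2 * k
    ≡⟨ ≡.cong (_∸ 2 * k) (exponentGG-square k m (suc n) eq) ⟩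
  suc n * suc n + 2 * (k * k) ∸ 2 * k
    -- One summand n + 1 of (n+1)² is rewritten as m + 2k, and its 2k absorbs the subtraction.
    ≡⟨ ≡.cong (λ l → l + n * suc n + 2 * (k * k) ∸ 2 * k) eq ⟨
  m + 2 * k + n * suc n + 2 * (k * k) ∸ 2 * k
    ≡⟨ ≡.cong (_∸ 2 * k) (rearrange m (2 * k) (n * suc n) (2 * (k * k))) ⟩
  n * suc n + m + 2 * (k * k) + 2 * k ∸ 2 * k
    ≡⟨ ℕ.m+n∸n≡m _ (2 * k) ⟩
  n * suc n + m + 2 * (k * k)
    ∎
  where
  open ≡.≡-Reasoning
  rearrange : ∀ m j l i → m + j + l + i ≡ l + m + i + j
  rearrange = solve-∀

module DoubleSumRecurrence {c ℓ} (R : CommutativeRing c ℓ) where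

  open CommutativeRing R renaming
    (Carrier to A; _≈_ to _∼_; _+_ to _⊕_; _*_ to _⊛_; -_ to ⊖_; 0# to 𝟎; 1# to 𝟏)
  open DiagonalSums commutativeSemiring
  open SemiringSolver commutativeSemiring using (solve; _:+_; _:*_; _:=_; con)
  open SetoidReasoning setoid

  inverse-unique : ∀ {x y z} → x ⊛ y ∼ 𝟏 → x ⊛ z ∼ 𝟏 → y ∼ z
  inverse-unique {x} {y} {z} xy≈1 xz≈1 = begin
    y            ≈⟨ *-identityʳ y ⟨
    y ⊛ 𝟏        ≈⟨ *-congˡ xz≈1 ⟨
    y ⊛ (x ⊛ z)  ≈⟨ solve 3 (λ x y z → y :* (x :* z) := (x :* y) :* z) refl x y z ⟩
    (x ⊛ y) ⊛ z  ≈⟨ *-congʳ xy≈1 ⟩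
    𝟏 ⊛ z        ≈⟨ *-identityˡ z ⟩
    z            ∎

  inverse-* : ∀ {x x′ y y′ z} → x ⊛ x′ ∼ 𝟏 → y ⊛ y′ ∼ 𝟏 → (x ⊛ y) ⊛ z ∼ 𝟏 → z ∼ x′ ⊛ y′
  inverse-* {x} {x′} {y} {y′} xx′≈1 yy′≈1 xyz≈1 = inverse-unique xyz≈1 (begin
    (x ⊛ y) ⊛ (x′ ⊛ y′)  ≈⟨ solve 4 (λ x x′ y y′ → (x :* y) :* (x′ :* y′) := (x :* x′) :* (y :* y′))
                             refl x x′ y y′ ⟩
    (x ⊛ x′) ⊛ (y ⊛ y′)  ≈⟨ *-cong xx′≈1 yy′≈1 ⟩
    𝟏 ⊛ 𝟏                ≈⟨ *-identityˡ 𝟏 ⟩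
    𝟏                    ∎)

  -- The product (1 - p) z is an inverse of x, hence equal to y. This yields the recurrence of
  -- reciprocal q-Pochhammer symbols.
  inverse-step : ∀ {x y z p} → x ⊛ y ∼ 𝟏 → (x ⊛ (𝟏 ⊕ ⊖ p)) ⊛ z ∼ 𝟏 → z ∼ y ⊕ p ⊛ z
  inverse-step {x} {y} {z} {p} xy≈1 xz≈1 = begin
    z
      ≈⟨ +-identityʳ z ⟨
    z ⊕ 𝟎
      ≈⟨ +-congˡ (trans (*-congʳ (-‿inverseˡ p)) (zeroˡ z)) ⟨
    z ⊕ (⊖ p ⊕ p) ⊛ z
      ≈⟨ solve 3 (λ z n p → z :+ (n :+ p) :* z := (con 1 :+ n) :* z :+ p :* z) refl z (⊖ p) p ⟩
    (𝟏 ⊕ ⊖ p) ⊛ z ⊕ p ⊛ z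
      ≈⟨ +-congʳ (inverse-unique xy≈1 (trans (sym (*-assoc _ _ _)) xz≈1)) ⟨
    y ⊕ p ⊛ z
      ∎

  pull-out : ∀ c z p {i j} → i ∼ j → ((c ⊛ z) ⊛ p) ⊛ i ∼ z ⊛ ((c ⊛ p) ⊛ j)
  pull-out c z p {i} {j} i≈j = trans (*-congˡ i≈j)
    (solve 4 (λ c z p j → ((c :* z) :* p) :* j := z :* ((c :* p) :* j)) refl c z p j)

  -- The inhomogeneous term r cancels, so the difference of two solutions is reproduced by p.
  difference-fixed : ∀ {g h p r} → g ∼ p ⊛ g ⊕ r → h ∼ p ⊛ h ⊕ r → g ⊕ ⊖ h ∼ p ⊛ (g ⊕ ⊖ h)
  difference-fixed {g} {h} {p} {r} g≈ h≈ = begin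
    g ⊕ ⊖ h
      ≈⟨ +-cong g≈ (-‿cong h≈) ⟩
    (p ⊛ g ⊕ r) ⊕ ⊖ (p ⊛ h ⊕ r)
      ≈⟨ +-congˡ (-‿+-comm _ _) ⟨
    (p ⊛ g ⊕ r) ⊕ (⊖ (p ⊛ h) ⊕ ⊖ r)
      ≈⟨ solve 4 (λ g r h s → (g :+ r) :+ (h :+ s) := (g :+ h) :+ (r :+ s)) refl _ _ _ _ ⟩
    (p ⊛ g ⊕ ⊖ (p ⊛ h)) ⊕ (r ⊕ ⊖ r)
      ≈⟨ +-cong (+-congˡ (-‿distribʳ-* p h)) (-‿inverseʳ r) ⟩
    (p ⊛ g ⊕ p ⊛ ⊖ h) ⊕ 𝟎
      ≈⟨ trans (+-identityʳ _) (sym (distribˡ _ _ _)) ⟩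
    p ⊛ (g ⊕ ⊖ h)
      ∎
    where open RingProperties ring using (-‿distribʳ-*; -‿+-comm)

  module _ (q : A) (a r : ℕ → A) (a-zero : a 0 ∼ 𝟏) (r-zero : r 0 ∼ 𝟏)
    (a-suc : ∀ m → a (suc m) ∼ a m ⊕ q ↑ suc m ⊛ a (suc m))
    (r-suc : ∀ k → r (suc k) ∼ r k ⊕ (q ↑ 4) ↑ suc k ⊛ r (suc k))
    where

    -- When `r k` is 1/(q⁴;q⁴)_k, these are Euler's coefficients of (z²q²;q⁴)_∞ in powers of z².
    b : ℕ → A
    b k = (⊖ 𝟏) ↑ k ⊛ q ↑ (2 * (k * k)) ⊛ r k

    term : (ℕ → ℕ → ℕ) → ℕ × ℕ → A
    term e (k , m) = (⊖ 𝟏) ↑ k ⊛ q ↑ e k m ⊛ (a m ⊛ r k)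

    -- From 2(k+1)² = 2k² + (4k+2) the two terms with `r k` differ only in sign and cancel; the
    -- recurrence of r supplies the factor q^(4k+4).
    b-suc : ∀ k → b (suc k) ⊕ q ↑ (4 * k + 2) ⊛ b k ∼ q ↑ (4 * k + 4) ⊛ b (suc k)
    b-suc k = begin
      (⊖ 𝟏) ↑ suc k ⊛ q ↑ (2 * (suc k * suc k)) ⊛ r (suc k) ⊕ q ↑ (4 * k + 2) ⊛ b k
        ≈⟨ +-cong (*-cong (*-congˡ split) r-suc′) refl ⟩
      (⊖ 𝟏 ⊛ s) ⊛ (E ⊛ F) ⊛ (r k ⊕ Q ⊛ r (suc k)) ⊕ E ⊛ (s ⊛ F ⊛ r k)
        ≈⟨ solve 7 (λ n s e f x y z → (n :* s) :* (e :* f) :* (x :+ y :* z) :+ e :* (s :* f :* x)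
             := (n :+ con 1) :* (s :* e :* f :* x) :+ y :* ((n :* s) :* (e :* f) :* z))
             refl (⊖ 𝟏) s E F (r k) Q (r (suc k)) ⟩
      (⊖ 𝟏 ⊕ 𝟏) ⊛ (s ⊛ E ⊛ F ⊛ r k) ⊕ Q ⊛ ((⊖ 𝟏 ⊛ s) ⊛ (E ⊛ F) ⊛ r (suc k))
        ≈⟨ +-cong (trans (*-congʳ (-‿inverseˡ 𝟏)) (zeroˡ _)) (*-congˡ (*-congʳ (*-congˡ (sym split)))) ⟩
      𝟎 ⊕ Q ⊛ b (suc k)
        ≈⟨ +-identityˡ _ ⟩
      Q ⊛ b (suc k)
        ∎
      where
      s = (⊖ 𝟏) ↑ k
      E = q ↑ (4 * k + 2)
      F = q ↑ (2 * (k * k))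
      Q = q ↑ (4 * k + 4)
      split : q ↑ (2 * (suc k * suc k)) ∼ E ⊛ F
      split = trans (^-congʳ q (exponent k)) (^-homo-* q (4 * k + 2) (2 * (k * k)))
        where
        exponent : ∀ k → 2 * (suc k * suc k) ≡ 4 * k + 2 + 2 * (k * k)
        exponent = solve-∀
      r-suc′ : r (suc k) ∼ r k ⊕ Q ⊛ r (suc k)
      r-suc′ = trans (r-suc k) (+-congˡ (*-congʳ
        (trans (^-assocʳ q 4 (suc k)) (^-congʳ q (exponent k)))))
        where
        exponent : ∀ k → 4 * suc k ≡ 4 * k + 4
        exponent = solve-∀

    private
      e₀ = d₀ q a b a-suc b-suc
      e₁ = d₁ q a b a-suc b-suc

    diagonalSum-GG : ∀ n → diagonalSum (term exponentGG) n ∼ q ↑ (n * n) ⊛ e₀ n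
    diagonalSum-GG n = trans (diagonalSum-cong n pointwise) (⨁-scale (q ↑ (n * n)) (antidiagonal n) _)
      where
      pointwise : ∀ k m → m + 2 * k ≡ n → term exponentGG (k , m) ∼ q ↑ (n * n) ⊛ (a m ⊛ b k)
      pointwise k m eq = begin
        (⊖ 𝟏) ↑ k ⊛ q ↑ exponentGG k m ⊛ (a m ⊛ r k)
          ≈⟨ *-congʳ (*-congˡ (trans (^-congʳ q (exponentGG-square k m n eq)) (^-homo-* q (n * n) _))) ⟩
        (⊖ 𝟏) ↑ k ⊛ (q ↑ (n * n) ⊛ q ↑ (2 * (k * k))) ⊛ (a m ⊛ r k)
          ≈⟨ solve 5 (λ s u v x y → s :* (u :* v) :* (x :* y) := u :* (x :* (s :* v :* y)))
               refl _ _ _ _ _ ⟩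
        q ↑ (n * n) ⊛ (a m ⊛ b k)
          ∎

    diagonalSum-G : ∀ n → diagonalSum (term exponentG) (suc n) ∼ q ↑ (n * suc n) ⊛ e₁ (suc n)
    diagonalSum-G n =
      trans (diagonalSum-cong (suc n) pointwise) (⨁-scale (q ↑ (n * suc n)) (antidiagonal (suc n)) _)
      where
      pointwise : ∀ k m → m + 2 * k ≡ suc n →
                  term exponentG (k , m) ∼ q ↑ (n * suc n) ⊛ (q ↑ m ⊛ a m ⊛ b k)
      pointwise k m eq = begin
        (⊖ 𝟏) ↑ k ⊛ q ↑ exponentG k m ⊛ (a m ⊛ r k)
          ≈⟨ *-congʳ (*-congˡ (trans (^-congʳ q (exponentG-square k m n eq))
               (trans (^-homo-* q (n * suc n + m) _) (*-congʳ (^-homo-* q (n * suc n) m))))) ⟩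
        (⊖ 𝟏) ↑ k ⊛ (q ↑ (n * suc n) ⊛ q ↑ m ⊛ q ↑ (2 * (k * k))) ⊛ (a m ⊛ r k)
          ≈⟨ solve 6 (λ s u w v x y → s :* (u :* w :* v) :* (x :* y) := u :* (w :* x :* (s :* v :* y)))
               refl _ _ _ _ _ _ ⟩
        q ↑ (n * suc n) ⊛ (q ↑ m ⊛ a m ⊛ b k)
          ∎

    diagonalSum-zero : ∀ e → e 0 0 ≡ 0 → diagonalSum (term e) 0 ∼ 𝟏
    diagonalSum-zero e e₀₀ = begin
      𝟏 ⊛ q ↑ e 0 0 ⊛ (a 0 ⊛ r 0) ⊕ 𝟎
        ≈⟨ +-congʳ (*-cong (*-congˡ (^-congʳ q e₀₀)) (*-cong a-zero r-zero)) ⟩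
      𝟏 ⊛ 𝟏 ⊛ (𝟏 ⊛ 𝟏) ⊕ 𝟎
        ≈⟨ solve 1 (λ z → con 1 :* con 1 :* (con 1 :* con 1) :+ con 0 := con 1) refl 𝟎 ⟩
      𝟏
        ∎

    private
      q^-square : ∀ n → q ↑ (suc n * suc n) ∼ q ↑ (2 * n + 1) ⊛ q ↑ (n * n)
      q^-square n = trans (^-congʳ q (exponent n)) (^-homo-* q (2 * n + 1) (n * n))
        where
        exponent : ∀ n → suc n * suc n ≡ 2 * n + 1 + n * n
        exponent = solve-∀

    -- The weight q^((n+1)²) = q^(2n+1) q^(n²) turns the factor q^(2n+1) + 1 of `d₀-recurrence` into
    -- q^(4n+2) + q^(2n+1), the contributions of the smallest parts 2 and 1.
    diagonalSum-GG-suc : ∀ n → diagonalSum (term exponentGG) (suc n) ∼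
      q ↑ (2 * n + 2) ⊛ diagonalSum (term exponentGG) (suc n)
        ⊕ (q ↑ (2 * n + 1) ⊕ q ↑ (4 * n + 2)) ⊛ diagonalSum (term exponentGG) n
    diagonalSum-GG-suc n = begin
      diagonalSum (term exponentGG) (suc n)
        ≈⟨ diagonalSum-GG (suc n) ⟩
      S ⊛ e₀ (suc n)
        ≈⟨ *-congˡ (d₀-recurrence q a b a-suc b-suc n) ⟩
      S ⊛ (P ⊛ e₀ (suc n) ⊕ (O ⊕ 𝟏) ⊛ e₀ n)
        ≈⟨ solve 5 (λ s p y o z → s :* (p :* y :+ (o :+ con 1) :* z)
             := p :* (s :* y) :+ s :* ((o :+ con 1) :* z)) refl _ _ _ _ _ ⟩
      P ⊛ (S ⊛ e₀ (suc n)) ⊕ S ⊛ ((O ⊕ 𝟏) ⊛ e₀ n)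
        ≈⟨ +-cong (*-congˡ (sym (diagonalSum-GG (suc n)))) (*-congʳ (q^-square n)) ⟩
      P ⊛ diagonalSum (term exponentGG) (suc n) ⊕ (O ⊛ T) ⊛ ((O ⊕ 𝟏) ⊛ e₀ n)
        ≈⟨ +-congˡ (solve 3 (λ o t z → (o :* t) :* ((o :+ con 1) :* z) := (o :+ o :* o) :* (t :* z))
             refl _ _ _) ⟩
      P ⊛ diagonalSum (term exponentGG) (suc n) ⊕ (O ⊕ O ⊛ O) ⊛ (T ⊛ e₀ n)
        ≈⟨ +-congˡ (*-cong (+-congˡ
               (trans (sym (^-homo-* q (2 * n + 1) (2 * n + 1))) (^-congʳ q (exponent n))))
             (sym (diagonalSum-GG n))) ⟩
      P ⊛ diagonalSum (term exponentGG) (suc n) ⊕ (O ⊕ q ↑ (4 * n + 2)) ⊛ diagonalSum (term exponentGG) n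
        ∎
      where
      S = q ↑ (suc n * suc n)
      T = q ↑ (n * n)
      P = q ↑ (2 * n + 2)
      O = q ↑ (2 * n + 1)
      exponent : ∀ n → 2 * n + 1 + (2 * n + 1) ≡ 4 * n + 2
      exponent = solve-∀

    -- The second family consists of coefficients of A(zq) B(z), which `d₁-d₀` expresses through
    -- those of H.
    diagonalSum-G-suc : ∀ n → diagonalSum (term exponentG) (suc n) ∼
      q ↑ suc n ⊛ diagonalSum (term exponentGG) (suc n) ⊕ q ↑ (3 * n + 1) ⊛ diagonalSum (term exponentGG) n
    diagonalSum-G-suc n = begin
      diagonalSum (term exponentG) (suc n)
        ≈⟨ diagonalSum-G n ⟩
      L ⊛ e₁ (suc n)
        ≈⟨ *-congˡ (d₁-d₀ q a b a-suc b-suc n) ⟩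
      L ⊛ (q ↑ (2 * n + 2) ⊛ e₀ (suc n) ⊕ q ↑ (2 * n + 1) ⊛ e₀ n)
        ≈⟨ solve 5 (λ l u y v z → l :* (u :* y :+ v :* z) := (l :* u) :* y :+ (l :* v) :* z)
             refl _ _ _ _ _ ⟩
      (L ⊛ q ↑ (2 * n + 2)) ⊛ e₀ (suc n) ⊕ (L ⊛ q ↑ (2 * n + 1)) ⊛ e₀ n
        ≈⟨ +-cong (*-congʳ (regroup (n * suc n) (2 * n + 2) (suc n) (suc n * suc n) (exponent₁ n)))
                  (*-congʳ (regroup (n * suc n) (2 * n + 1) (3 * n + 1) (n * n) (exponent₂ n))) ⟩
      (q ↑ suc n ⊛ q ↑ (suc n * suc n)) ⊛ e₀ (suc n) ⊕ (q ↑ (3 * n + 1) ⊛ q ↑ (n * n)) ⊛ e₀ n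
        ≈⟨ +-cong (trans (*-assoc _ _ _) (*-congˡ (sym (diagonalSum-GG (suc n)))))
                  (trans (*-assoc _ _ _) (*-congˡ (sym (diagonalSum-GG n)))) ⟩
      q ↑ suc n ⊛ diagonalSum (term exponentGG) (suc n) ⊕ q ↑ (3 * n + 1) ⊛ diagonalSum (term exponentGG) n
        ∎
      where
      L = q ↑ (n * suc n)
      regroup : ∀ i j k l → i + j ≡ k + l → q ↑ i ⊛ q ↑ j ∼ q ↑ k ⊛ q ↑ l
      regroup i j k l eq = trans (sym (^-homo-* q i j)) (trans (^-congʳ q eq) (^-homo-* q k l))
      exponent₁ : ∀ n → n * suc n + (2 * n + 2) ≡ suc n + suc n * suc n
      exponent₁ = solve-∀
      exponent₂ : ∀ n → n * suc n + (2 * n + 1) ≡ 3 * n + 1 + n * n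
      exponent₂ = solve-∀

-- The rings ℤ[x] and ℤ[x]⟦q⟧

open Vanishing

module ℤ⟦x⟧ = PowerSeries ℤ.+-*-commutativeRing

polyRing : RawRing 0ℓ 0ℓ
polyRing = record
  { Carrier = Poly ; _≈_ = _≈ᵖ_
  ; _+_ = _+ᵖ_ ; _*_ = _*ᵖ_ ; -_ = -ᵖ_ ; 0# = 0ᵖ ; 1# = 1ᵖ }

coeff-neg : ∀ p n → coeff (-ᵖ p) n ≡ ℤ.- coeff p n
coeff-neg []      n       = ≡.refl
coeff-neg (a ∷ p) zero    = ≡.refl
coeff-neg (a ∷ p) (suc n) = coeff-neg p n

coeff-* : ∀ p r n → coeff (p *ᵖ r) n ≡ (coeff p ℤ⟦x⟧.⋆ coeff r) n
coeff-* []      r n       = ≡.sym (ℤ⟦x⟧.⋆-zeroˡ (coeff r) n)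
coeff-* (a ∷ p) r zero    = ≡.trans (coeff-+ (map (a ℤ.*_) r) _ 0)
  (≡.trans (ℤ.+-identityʳ _) (coeff-scale a r 0))
coeff-* (a ∷ p) r (suc n) = ≡.trans (coeff-+ (map (a ℤ.*_) r) _ (suc n))
  (≡.cong₂ ℤ._+_ (coeff-scale a r (suc n)) (coeff-* p r n))

-- Equality of polynomials is equality of coefficients, so injectivity is immediate and the ring
-- laws of ℤ[x] are inherited from sequences over ℤ.
coeff-isRingMonomorphism :
  IsRingMonomorphism polyRing (CommutativeRing.rawRing ℤ⟦x⟧.commutativeRing) coeff
coeff-isRingMonomorphism = record
  { isRingHomomorphism = record
    { isSemiringHomomorphism = record
      { isNearSemiringHomomorphism = record
        { +-isMonoidHomomorphism = record
          { isMagmaHomomorphism = record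
            { isRelHomomorphism = record { cong = id }
            ; homo = coeff-+
            }
          ; ε-homo = λ _ → ≡.refl
          }
        ; *-homo = coeff-*
        }
      ; 1#-homo = λ { zero → ≡.refl ; (suc _) → ≡.refl }
      }
    ; -‿homo = coeff-neg
    }
  ; injective = id
  }

polyCommutativeRing : CommutativeRing 0ℓ 0ℓ
polyCommutativeRing = record
  { isCommutativeRing = RingMonomorphism.isCommutativeRing coeff-isRingMonomorphism
      (CommutativeRing.isCommutativeRing ℤ⟦x⟧.commutativeRing) }

-- _≈ᵖ_ and _≈_ unfold to families of equations, from which Agda cannot recover the two sides; the
-- implicit arguments of the ring laws are therefore often given explicitly from here on.
module ℤ[x] = CommutativeRing polyCommutativeRing
module ℤ[x]⟦q⟧ = PowerSeries polyCommutativeRing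

sumᵖ-antidiagonal : ∀ (f g : Series) n →
  sumᵖ (map (λ i → f i *ᵖ g (n ∸ i)) (upTo (suc n))) ≈ᵖ (f ℤ[x]⟦q⟧.⋆ g) n
sumᵖ-antidiagonal f g zero    = ℤ[x].+-identityʳ (f 0 *ᵖ g 0)
sumᵖ-antidiagonal f g (suc n) = begin
  f 0 *ᵖ g (suc n) +ᵖ sumᵖ (map (λ i → f i *ᵖ g (suc n ∸ i)) (applyUpTo suc (suc n)))
    ≡⟨ ≡.cong (λ ps → f 0 *ᵖ g (suc n) +ᵖ sumᵖ ps)
         (≡.trans (List.map-applyUpTo suc (λ i → f i *ᵖ g (suc n ∸ i)) (suc n))
           (≡.sym (List.map-upTo (λ i → f (suc i) *ᵖ g (n ∸ i)) (suc n)))) ⟩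
  f 0 *ᵖ g (suc n) +ᵖ sumᵖ (map (λ i → f (suc i) *ᵖ g (n ∸ i)) (upTo (suc n)))
    ≈⟨ ℤ[x].+-congˡ {f 0 *ᵖ g (suc n)} (sumᵖ-antidiagonal (f ∘ suc) g n) ⟩
  f 0 *ᵖ g (suc n) +ᵖ (f ∘ suc ℤ[x]⟦q⟧.⋆ g) n
    ∎
  where open SetoidReasoning ℤ[x].setoid

*ˢ≈⋆ : ∀ f g → f *ˢ g ≈ f ℤ[x]⟦q⟧.⋆ g
*ˢ≈⋆ f g n = sumᵖ-antidiagonal f g n

id-isRingMonomorphism :
  IsRingMonomorphism seriesRing (CommutativeRing.rawRing ℤ[x]⟦q⟧.commutativeRing) id
id-isRingMonomorphism = record
  { isRingHomomorphism = record
    { isSemiringHomomorphism = record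
      { isNearSemiringHomomorphism = record
        { +-isMonoidHomomorphism = record
          { isMagmaHomomorphism = record
            { isRelHomomorphism = record { cong = id }
            ; homo = λ f g n i → ≡.refl
            }
          ; ε-homo = λ { zero i → ≡.refl ; (suc _) i → ≡.refl }
          }
        ; *-homo = *ˢ≈⋆
        }
      ; 1#-homo = λ { zero i → ≡.refl ; (suc _) i → ≡.refl }
      }
    ; -‿homo = λ f n i → ≡.refl
    }
  ; injective = id
  }

seriesCommutativeRing : CommutativeRing 0ℓ 0ℓ
seriesCommutativeRing = record
  { isCommutativeRing = RingMonomorphism.isCommutativeRing id-isRingMonomorphism
      (CommutativeRing.isCommutativeRing ℤ[x]⟦q⟧.commutativeRing) }

module ℤ[x,q] = CommutativeRing seriesCommutativeRing
module ∑ᵖ = FiniteSums ℤ[x].+-commutativeMonoid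

q*-zero : ∀ f → (q *ˢ f) 0 ≈ᵖ 0ᵖ
q*-zero f = *ˢ≈⋆ q f 0

q*-suc : ∀ f n → (q *ˢ f) (suc n) ≈ᵖ f n
q*-suc f n = begin
  (q *ˢ f) (suc n)         ≈⟨ *ˢ≈⋆ q f (suc n) ⟩
  (1ˢ ℤ[x]⟦q⟧.⋆ f) n       ≈⟨ ℤ[x]⟦q⟧.⋆-constantˡ 1ᵖ 1ˢ f (ℤ[x].refl {1ᵖ}) (λ _ → ℤ[x].refl {0ᵖ}) n ⟩
  1ᵖ *ᵖ f n                ≈⟨ ℤ[x].*-identityˡ (f n) ⟩
  f n                      ∎
  where open SetoidReasoning ℤ[x].setoid

-- Generating functions of partitions with a fixed number of parts

record Enumeration (P : Pred (List ℕ) 0ℓ) : Set where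
  field
    list     : ℕ → List (List ℕ)
    unique   : ∀ n → Unique (list n)
    sound    : ∀ {n μ} → μ ∈ list n → P μ × sum μ ≡ n
    complete : ∀ {n μ} → P μ → sum μ ≡ n → μ ∈ list n

open Enumeration

-- The coefficient of q^n is the number of members with sum n. The variable x is left out here; it
-- enters as x^n once the number n of parts is fixed.
gf : ∀ {P} → Enumeration P → Series
gf e n = ∑ᵖ.⨁ (list e n) (λ _ → 1ᵖ)

gf-cong : ∀ {P Q} (d : Enumeration P) (e : Enumeration Q) →
          (∀ μ → P μ → Q μ) → (∀ μ → Q μ → P μ) → gf d ≈ gf e
gf-cong d e P⊆Q Q⊆P n = ∑ᵖ.⨁-set {S = list d n} {T = list e n} (λ _ → 1ᵖ) (unique d n) (unique e n)
  (λ μ μ∈ → let Pμ , eq = sound d μ∈ in complete e (P⊆Q μ Pμ) eq)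
  (λ μ μ∈ → let Qμ , eq = sound e μ∈ in complete d (Q⊆P μ Qμ) eq)

union : ∀ {P Q} → Enumeration P → Enumeration Q → (∀ μ → P μ → ¬ Q μ) → Enumeration (P ∪ Q)
union d e disjoint = record
  { list     = λ n → list d n ++ list e n
  ; unique   = λ n → Unique.++⁺ (unique d n) (unique e n)
      (λ (μ∈d , μ∈e) → disjoint _ (proj₁ (sound d μ∈d)) (proj₁ (sound e μ∈e)))
  ; sound    = λ {n} μ∈ → case ∈-++⁻ (list d n) μ∈ of λ where
      (inj₁ μ∈d) → let Pμ , eq = sound d μ∈d in inj₁ Pμ , eq
      (inj₂ μ∈e) → let Qμ , eq = sound e μ∈e in inj₂ Qμ , eq
  ; complete = λ {n} → λ where
      (inj₁ Pμ) eq → ∈-++⁺ˡ (complete d Pμ eq)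
      (inj₂ Qμ) eq → ∈-++⁺ʳ (list d n) (complete e Qμ eq)
  }

gf-union : ∀ {P Q} (d : Enumeration P) (e : Enumeration Q) disjoint →
           gf (union d e disjoint) ≈ gf d +ˢ gf e
gf-union d e disjoint n = ∑ᵖ.⨁-++ (list d n) (list e n) (λ _ → 1ᵖ)

module _ {A : Set} where

  -- Multiplication by q^c at the level of lists.
  delay : ℕ → (ℕ → List A) → ℕ → List A
  delay zero    f n       = f n
  delay (suc c) f zero    = []
  delay (suc c) f (suc n) = delay c f n

  delay-unique : ∀ c f → (∀ n → Unique (f n)) → ∀ n → Unique (delay c f n)
  delay-unique zero    f u n       = u n
  delay-unique (suc c) f u zero    = []
  delay-unique (suc c) f u (suc n) = delay-unique c f u n

  ∈-delay⁻ : ∀ c f n {y} → y ∈ delay c f n → ∃ λ k → c + k ≡ n × y ∈ f k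
  ∈-delay⁻ zero    f n       y∈ = n , ≡.refl , y∈
  ∈-delay⁻ (suc c) f (suc n) y∈ = let k , eq , y∈f = ∈-delay⁻ c f n y∈ in k , ≡.cong suc eq , y∈f

  ∈-delay⁺ : ∀ c f k {y} → y ∈ f k → y ∈ delay c f (c + k)
  ∈-delay⁺ zero    f k y∈ = y∈
  ∈-delay⁺ (suc c) f k y∈ = ∈-delay⁺ c f k y∈

  delay-gf : ∀ c (f : ℕ → List A) →
             (λ n → ∑ᵖ.⨁ (delay c f n) (λ _ → 1ᵖ)) ≈ q ^ˢ c *ˢ (λ n → ∑ᵖ.⨁ (f n) (λ _ → 1ᵖ))
  delay-gf zero    f n = ℤ[x].sym {(1ˢ *ˢ F) n} {F n} (ℤ[x,q].*-identityˡ F n)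
    where F = λ n → ∑ᵖ.⨁ (f n) (λ _ → 1ᵖ)
  delay-gf (suc c) f n = begin
    ∑ᵖ.⨁ (delay (suc c) f n) (λ _ → 1ᵖ)  ≈⟨ step n ⟩
    (q *ˢ (q ^ˢ c *ˢ F)) n                ≈⟨ ℤ[x,q].*-assoc q (q ^ˢ c) F n ⟨
    (q ^ˢ suc c *ˢ F) n                   ∎
    where
    open SetoidReasoning ℤ[x].setoid
    F = λ n → ∑ᵖ.⨁ (f n) (λ _ → 1ᵖ)
    step : ∀ n → ∑ᵖ.⨁ (delay (suc c) f n) (λ _ → 1ᵖ) ≈ᵖ (q *ˢ (q ^ˢ c *ˢ F)) n
    step zero    = ℤ[x].sym {(q *ˢ (q ^ˢ c *ˢ F)) 0} {0ᵖ} (q*-zero (q ^ˢ c *ˢ F))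
    step (suc n) = begin
      ∑ᵖ.⨁ (delay c f n) (λ _ → 1ᵖ)    ≈⟨ delay-gf c f n ⟩
      (q ^ˢ c *ˢ F) n                   ≈⟨ q*-suc (q ^ˢ c *ˢ F) n ⟨
      (q *ˢ (q ^ˢ c *ˢ F)) (suc n)      ∎

Image : (List ℕ → List ℕ) → Pred (List ℕ) 0ℓ → Pred (List ℕ) 0ℓ
Image f P μ = ∃ λ ν → P ν × μ ≡ f ν

-- The gain c in the sum is asked for on P only: the gain of `raise` depends on the length, which P
-- will fix.
image : ∀ {P} f → Injective _≡_ _≡_ f → ∀ c → (∀ μ → P μ → sum (f μ) ≡ c + sum μ) →
        Enumeration P → Enumeration (Image f P)
image f injective c sum-f e = record
  { list     = delay c (map f ∘ list e)
  ; unique   = delay-unique c (map f ∘ list e) (λ n → Unique.map⁺ injective (unique e n))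
  ; sound    = λ {n} μ∈ →
      let k , c+k≡n , μ∈′ = ∈-delay⁻ c (map f ∘ list e) n μ∈
          ν , ν∈ , eq     = ∈-map⁻ f μ∈′
          Pν , sum≡       = sound e ν∈
      in (ν , Pν , eq)
       , ≡.trans (≡.cong sum eq) (≡.trans (sum-f ν Pν) (≡.trans (≡.cong (c +_) sum≡) c+k≡n))
  ; complete = λ { (ν , Pν , ≡.refl) eq →
      ≡.subst (λ n → f ν ∈ delay c (map f ∘ list e) n) (≡.trans (≡.sym (sum-f ν Pν)) eq)
        (∈-delay⁺ c (map f ∘ list e) (sum ν) (∈-map⁺ f (complete e Pν ≡.refl))) }
  }

gf-image : ∀ {P} f (injective : Injective _≡_ _≡_ f) c sum-f (e : Enumeration P) →
           gf (image f injective c sum-f e) ≈ q ^ˢ c *ˢ gf e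
gf-image f injective c sum-f e n = begin
  ∑ᵖ.⨁ (delay c (map f ∘ list e) n) (λ _ → 1ᵖ)
    ≈⟨ delay-gf c (map f ∘ list e) n ⟩
  (q ^ˢ c *ˢ (λ n → ∑ᵖ.⨁ (map f (list e n)) (λ _ → 1ᵖ))) n
    ≈⟨ ℤ[x,q].*-congˡ {q ^ˢ c} {λ n → ∑ᵖ.⨁ (map f (list e n)) (λ _ → 1ᵖ)} {gf e}
         (λ n → ℤ[x].reflexive (∑ᵖ.⨁-map f (list e n) (λ _ → 1ᵖ))) n ⟩
  (q ^ˢ c *ˢ gf e) n
    ∎
  where open SetoidReasoning ℤ[x].setoid

-- All pairs are compared, not only neighbours. For the transitive gap relations this is equivalent,
-- and it behaves well under removing the last part.
Parts : Rel ℕ 0ℓ → ℕ → Pred (List ℕ) 0ℓ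
Parts _∼_ n μ = All (0 <_) μ × AllPairs _∼_ μ × length μ ≡ n

raise : ℕ → List ℕ → List ℕ
raise c = map (c +_)

-- Inverse to deleting the smallest part s, which stands last, and lowering the others by c.
raiseWith : ℕ → ℕ → List ℕ → List ℕ
raiseWith c s μ = raise c μ ∷ʳ s

raise-injective : ∀ c {μ ν} → raise c μ ≡ raise c ν → μ ≡ ν
raise-injective c = List.map-injective (ℕ.+-cancelˡ-≡ c _ _)

raiseWith-injective : ∀ c s {μ ν} → raiseWith c s μ ≡ raiseWith c s ν → μ ≡ ν
raiseWith-injective c s {μ} {ν} = raise-injective c ∘ List.∷ʳ-injectiveˡ (raise c μ) (raise c ν)

sum-raise : ∀ c μ → sum (raise c μ) ≡ c * length μ + sum μ
sum-raise c []      rewrite ℕ.*-zeroʳ c = ≡.refl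
sum-raise c (a ∷ μ) = ≡.trans (≡.cong (c + a +_) (sum-raise c μ)) (rearrange c a (length μ) (sum μ))
  where
  rearrange : ∀ c a l s → c + a + (c * l + s) ≡ c * suc l + (a + s)
  rearrange = solve-∀

sum-raiseWith : ∀ c s μ → sum (raiseWith c s μ) ≡ c * length μ + s + sum μ
sum-raiseWith c s μ = ≡.trans (sum-++ (raise c μ) [ s ])
  (≡.trans (≡.cong (_+ (s + 0)) (sum-raise c μ)) (rearrange (c * length μ) s (sum μ)))
  where
  rearrange : ∀ l s t → l + t + (s + 0) ≡ l + s + t
  rearrange = solve-∀

lower : ∀ c μ → All (c <_) μ → ∃ λ ν → All (0 <_) ν × μ ≡ raise c ν
lower c []      []          = [] , [] , ≡.refl
lower c (a ∷ μ) (c<a ∷ μ>c) =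
  let ν , ν>0 , eq = lower c μ μ>c
  in a ∸ c ∷ ν , ℕ.m<n⇒0<n∸m c<a ∷ ν>0 , ≡.cong₂ _∷_ (≡.sym (ℕ.m+[n∸m]≡n (ℕ.<⇒≤ c<a))) eq

All-raise : ∀ c μ → All (0 <_) μ → All (c <_) (raise c μ)
All-raise c μ μ>0 = All.map⁺ (All.map (λ 0<a → ℕ.m<m+n c 0<a) μ>0)

AllPairs-∷ʳ⁺ : ∀ {R : Rel ℕ 0ℓ} {μ s} → AllPairs R μ → All (λ a → R a s) μ → AllPairs R (μ ∷ʳ s)
AllPairs-∷ʳ⁺ μR μs = AllPairs.++⁺ μR ([] ∷ []) (All.map (_∷ []) μs)

AllPairs-∷ʳ⁻ : ∀ {R : Rel ℕ 0ℓ} μ {s} → AllPairs R (μ ∷ʳ s) → AllPairs R μ × All (λ a → R a s) μ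
AllPairs-∷ʳ⁻ []      _         = [] , []
AllPairs-∷ʳ⁻ (a ∷ μ) (aR ∷ μR) =
  let μR′ , μs = AllPairs-∷ʳ⁻ μ μR
      aR′ , as = All.++⁻ μ aR
  in aR′ ∷ μR′ , All.head as ∷ μs

record Translates (c : ℕ) (Q R : Rel ℕ 0ℓ) : Set where
  field
    up   : ∀ a b → Q a b → R (c + a) (c + b)
    down : ∀ a b → R (c + a) (c + b) → Q a b

open Translates

raise-Parts : ∀ {c Q R n} → Translates c Q R → ∀ {μ} → Image (raise c) (Parts Q n) μ →
              Parts R n μ × All (c <_) μ
raise-Parts {c} t (ν , (ν>0 , νQ , len) , ≡.refl) =
  ( All.map (ℕ.≤-<-trans z≤n) (All-raise c ν ν>0)
  , AllPairs.map⁺ (AllPairs.map (up t _ _) νQ)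
  , ≡.trans (List.length-map (c +_) ν) len)
  , All-raise c ν ν>0

lower-Parts : ∀ {c Q R n} → Translates c Q R → ∀ {μ} → Parts R n μ → All (c <_) μ →
              Image (raise c) (Parts Q n) μ
lower-Parts {c} t {μ} (_ , μR , len) μ>c with lower c μ μ>c
... | ν , ν>0 , ≡.refl =
  ν , (ν>0 , AllPairs.map (down t _ _) (AllPairs.map⁻ μR)
          , ≡.trans (≡.sym (List.length-map (c +_) ν)) len)
    , ≡.refl

length-∷ʳ : ∀ (μ : List ℕ) s → length (μ ∷ʳ s) ≡ suc (length μ)
length-∷ʳ μ s = ≡.trans (List.length-++ μ) (ℕ.+-comm (length μ) 1)

-- The parts that may precede a last part s are exactly those above c, that is, those that stay
-- positive when lowered by c.
record Threshold (c s : ℕ) (R : Rel ℕ 0ℓ) : Set where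
  field
    above : ∀ a → R a s → c < a
    below : ∀ a → c < a → R a s

open Threshold

raiseWith-Parts : ∀ {c s Q R n} → Translates c Q R → Threshold c s R → 0 < s →
                  ∀ {μ} → Image (raiseWith c s) (Parts Q n) μ → Parts R (suc n) μ
raiseWith-Parts {c} {s} t th 0<s (ν , Pν , ≡.refl) =
  let (μ>0 , μR , len) , μ>c = raise-Parts t (ν , Pν , ≡.refl)
  in All.++⁺ μ>0 (0<s ∷ [])
   , AllPairs-∷ʳ⁺ μR (All.map (below th _) μ>c)
   , ≡.trans (length-∷ʳ (raise c ν) s) (≡.cong suc len)

lowerWith-Parts : ∀ {c s Q R n} → Translates c Q R → Threshold c s R →
                  ∀ μ → Parts R (suc n) (μ ∷ʳ s) → Image (raiseWith c s) (Parts Q n) (μ ∷ʳ s)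
lowerWith-Parts {s = s} t th μ (μ>0 , μR , len) =
  let μR′ , μs = AllPairs-∷ʳ⁻ μ μR
      ν , Pν , eq = lower-Parts t
        (All.++⁻ˡ μ μ>0 , μR′ , ℕ.suc-injective (≡.trans (≡.sym (length-∷ʳ μ s)) len))
        (All.map (above th _) μs)
  in ν , Pν , ≡.cong (_∷ʳ s) eq

-- Parts are decreasing, so all of them exceed c as soon as the last one does.
All-above : ∀ {R : Rel ℕ 0ℓ} → (∀ {a b} → R a b → b < a) →
            ∀ {c s} μ → AllPairs R (μ ∷ʳ s) → c < s → All (c <_) (μ ∷ʳ s)
All-above R⇒> μ μR c<s =
  let _ , μs = AllPairs-∷ʳ⁻ μ μR
  in All.++⁺ (All.map (λ aRs → ℕ.<-trans c<s (R⇒> aRs)) μs) (c<s ∷ [])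

last-> : ∀ {c s} μ → All (c <_) (μ ∷ʳ s) → c < s
last-> μ μ>c = All.head (All.++⁻ʳ μ μ>c)

-- Parity and the two gap relations

even⇒even+2 : ∀ {a} → 2 ∣ a → 2 ∣ 2 + a
even⇒even+2 = ∣m∣n⇒∣m+n ∣-refl

even+2⇒even : ∀ {a} → 2 ∣ 2 + a → 2 ∣ a
even+2⇒even 2∣2+a = ∣m+n∣m⇒∣n 2∣2+a ∣-refl

2∤1 : ¬ 2 ∣ 1
2∤1 = from-no (2 ∣? 1)

2∤3 : ¬ 2 ∣ 3
2∤3 = from-no (2 ∣? 3)

even⇒odd-suc : ∀ a → 2 ∣ a → ¬ 2 ∣ suc a
even⇒odd-suc zero          _    = 2∤1
even⇒odd-suc (suc zero)    2∣1  = contradiction 2∣1 2∤1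
even⇒odd-suc (suc (suc a)) even = even⇒odd-suc a (even+2⇒even even) ∘ even+2⇒even

odd-suc⇒even : ∀ a → ¬ 2 ∣ suc a → 2 ∣ a
odd-suc⇒even zero          _   = 2 ∣0
odd-suc⇒even (suc zero)    odd = contradiction ∣-refl odd
odd-suc⇒even (suc (suc a)) odd = even⇒even+2 (odd-suc⇒even a (odd ∘ even⇒even+2))

gap⇒> : ∀ a b → 2 ≤ a ∸ b → b < a
gap⇒> (suc a) zero    _   = s≤s z≤n
gap⇒> (suc a) (suc b) gap = s≤s (gap⇒> a b gap)

GGGap⇒> : ∀ {a b} → GGGap a b → b < a
GGGap⇒> {a} {b} = gap⇒> a b ∘ proj₁

GGap⇒> : ∀ {a b} → GGap a b → b < a
GGap⇒> {a} {b} = gap⇒> a b ∘ proj₁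

-- Two gaps of at least 2 add up to at least 4, so the strict inequality holds whatever the
-- parities; both gap relations are therefore transitive.
gap-trans : ∀ a b c → 2 ≤ a ∸ b → 2 ≤ b ∸ c → 2 < a ∸ c
gap-trans a b c 2≤a∸b 2≤b∸c = ℕ.≤-trans (ℕ.n≤1+n 3) (ℕ.m+n≤o⇒m≤o∸n 4 (begin
  2 + (2 + c)  ≤⟨ ℕ.+-monoʳ-≤ 2 (ℕ.m≤o∸n⇒m+n≤o 2 (ℕ.<⇒≤ (gap⇒> b c 2≤b∸c)) 2≤b∸c) ⟩
  2 + b        ≤⟨ ℕ.m≤o∸n⇒m+n≤o 2 (ℕ.<⇒≤ (gap⇒> a b 2≤a∸b)) 2≤a∸b ⟩
  a            ∎))
  where open ℕ.≤-Reasoning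

GGGap-trans : Transitive GGGap
GGGap-trans {a} {b} {c} (ab , _) (bc , _) =
  let gap = gap-trans a b c ab bc in ℕ.<⇒≤ gap , λ _ → gap

GGap-trans : Transitive GGap
GGap-trans {a} {b} {c} (ab , _) (bc , _) =
  let gap = gap-trans a b c ab bc in ℕ.<⇒≤ gap , λ _ → gap

GGGap-translates : Translates 2 GGGap GGGap
GGGap-translates = record
  { up   = λ a b (gap , strict) → gap , strict ∘ Sum.map even+2⇒even even+2⇒even
  ; down = λ a b (gap , strict) → gap , strict ∘ Sum.map even⇒even+2 even⇒even+2
  }

GGap-translates : Translates 2 GGap GGap
GGap-translates = record
  { up   = λ a b (gap , strict) → gap , strict ∘ Sum.map (_∘ even⇒even+2) (_∘ even⇒even+2)
  ; down = λ a b (gap , strict) → gap , strict ∘ Sum.map (_∘ even+2⇒even) (_∘ even+2⇒even)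
  }

-- A shift by 1 preserves differences and exchanges even and odd, which is the only distinction
-- between the two relations.
GGGap-GGap : Translates 1 GGGap GGap
GGGap-GGap = record
  { up   = λ a b (gap , strict) → gap , strict ∘ Sum.map (odd-suc⇒even a) (odd-suc⇒even b)
  ; down = λ a b (gap , strict) → gap , strict ∘ Sum.map (even⇒odd-suc a) (even⇒odd-suc b)
  }

Translates-trans : ∀ {c d P Q R} → Translates c P Q → Translates d Q R → Translates (d + c) P R
Translates-trans {c} {d} {R = R} t u = record
  { up   = λ a b Pab → ≡.subst₂ R (≡.sym (ℕ.+-assoc d c a)) (≡.sym (ℕ.+-assoc d c b))
                         (up u _ _ (up t a b Pab))
  ; down = λ a b Rab → down t a b (down u _ _
                         (≡.subst₂ R (ℕ.+-assoc d c a) (ℕ.+-assoc d c b) Rab))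
  }

-- The gap 2 above the part 1 is reached only by 3; both are odd, so it is allowed.
GGGap-1 : Threshold 2 1 GGGap
GGGap-1 = record
  { above = λ { (suc a) (gap , _) → s≤s gap }
  ; below = λ { (suc a) (s≤s 2≤a) → 2≤a , strict a 2≤a }
  }
  where
  strict : ∀ a → 2 ≤ a → 2 ∣ suc a ⊎ 2 ∣ 1 → 2 < a
  strict a 2≤a (inj₂ 2∣1) = contradiction 2∣1 2∤1
  strict a 2≤a (inj₁ 2∣a) = ℕ.≤∧≢⇒< 2≤a λ { ≡.refl → 2∤3 2∣a }

-- The part 2 is even, so the gap above it must exceed 2.
GGGap-2 : Threshold 4 2 GGGap
GGGap-2 = record
  { above = λ { (suc (suc a)) (_ , strict) → s≤s (s≤s (strict (inj₂ ∣-refl))) }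
  ; below = λ { (suc (suc a)) (s≤s (s≤s 2<a)) → ℕ.<⇒≤ 2<a , λ _ → 2<a }
  }

GGap-1 : Threshold 3 1 GGap
GGap-1 = record
  { above = λ { (suc a) (_ , strict) → s≤s (strict (inj₂ 2∤1)) }
  ; below = λ { (suc a) (s≤s 2<a) → ℕ.<⇒≤ 2<a , λ _ → 2<a }
  }

-- Enumerations of both families by number of parts

Separated : Rel ℕ 0ℓ → Pred (List ℕ) 0ℓ
Separated R μ = IsPartition μ × Linked R μ

module _ {R : Rel ℕ 0ℓ} (R-trans : Transitive R) (R⇒> : ∀ {a b} → R a b → b < a) where

  Separated⇒Parts : ∀ {n μ} → Separated R μ → length μ ≡ n → Parts R n μ
  Separated⇒Parts ((μ>0 , _) , μR) len = μ>0 , Linked.Linked⇒AllPairs R-trans μR , len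

  Parts⇒Separated : ∀ {n μ} → Parts R n μ → Separated R μ
  Parts⇒Separated (μ>0 , μR , _) =
    (μ>0 , Linked.AllPairs⇒Linked (AllPairs.map (ℕ.<⇒≤ ∘ R⇒>) μR)) , Linked.AllPairs⇒Linked μR

  -- Completeness of s only says that weights off the support vanish, so membership is asked for
  -- separately. The support at N may also hold partitions with other sums, hence the filter on the
  -- sum.
  enumerate : (s : Summable (Separated R) weight) →
              (∀ μ → Separated R μ → μ ∈ Summable.support s (sum μ)) →
              ∀ n → Enumeration (Parts R n)
  enumerate s in-support n = record
    { list     = λ N → filter (P? N) (Summable.support s N)
    ; unique   = λ N → Unique.filter⁺ (P? N) (Summable.unique s N)
    ; sound    = λ {N} μ∈ →
        let μ∈′ , len , eq = ∈-filter⁻ (P? N) μ∈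
        in Separated⇒Parts (All.lookup (Summable.sound s N) μ∈′) len , eq
    ; complete = λ { {μ = μ} Pμ@(_ , _ , len) ≡.refl →
        ∈-filter⁺ (P? (sum μ)) (in-support μ (Parts⇒Separated Pμ)) (len , ≡.refl) }
    }
    where P? = λ N μ → length μ ℕ.≟ n ×-dec sum μ ℕ.≟ N

partitionsGG : ∀ n → Enumeration (Parts GGGap n)
partitionsGG = enumerate GGGap-trans GGGap⇒> GöllnitzGordon-summable λ μ Pμ@((μ>0 , _) , _) →
  ∈-filter⁺ (λ μ → isPartition? μ ×-dec linked? ggGap? μ)
    (∈-deduplicate⁺ (List.≡-dec ℕ._≟_)
      (∈-lists (sum μ) (sum μ) μ μ>0 ℕ.≤-refl ℕ.≤-refl)) Pμ

partitionsG : ∀ n → Enumeration (Parts GGap n)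
partitionsG = enumerate GGap-trans GGap⇒> Göllnitz-summable λ μ Pμ@((μ>0 , _) , _) →
  ∈-filter⁺ (λ μ → isPartition? μ ×-dec linked? gGap? μ)
    (∈-deduplicate⁺ (List.≡-dec ℕ._≟_)
      (∈-lists (sum μ) (sum μ) μ μ>0 ℕ.≤-refl ℕ.≤-refl)) Pμ

-- Decomposition by the smallest part

splitGG : ∀ n μ → Parts GGGap (suc n) μ →
  (Image (raise 2) (Parts GGGap (suc n))
    ∪ (Image (raiseWith 2 1) (Parts GGGap n) ∪ Image (raiseWith 4 2) (Parts GGGap n))) μ
splitGG n μ Pμ@(μ>0 , μR , len) with initLast μ
... | [] = contradiction len λ ()
... | ν ∷ʳ′ zero = contradiction (last-> ν μ>0) λ ()
... | ν ∷ʳ′ 1 = inj₂ (inj₁ (lowerWith-Parts GGGap-translates GGGap-1 ν Pμ))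
... | ν ∷ʳ′ 2 = inj₂ (inj₂ (lowerWith-Parts
  (Translates-trans GGGap-translates GGGap-translates) GGGap-2 ν Pμ))
... | ν ∷ʳ′ suc (suc (suc s)) = inj₁ (lower-Parts GGGap-translates Pμ
  (All-above GGGap⇒> ν μR (s≤s (s≤s (s≤s z≤n)))))

joinGG : ∀ n μ →
  (Image (raise 2) (Parts GGGap (suc n))
    ∪ (Image (raiseWith 2 1) (Parts GGGap n) ∪ Image (raiseWith 4 2) (Parts GGGap n))) μ →
  Parts GGGap (suc n) μ
joinGG n μ (inj₁ i)        = proj₁ (raise-Parts GGGap-translates i)
joinGG n μ (inj₂ (inj₁ i)) = raiseWith-Parts GGGap-translates GGGap-1 z<s i
joinGG n μ (inj₂ (inj₂ i)) =
  raiseWith-Parts (Translates-trans GGGap-translates GGGap-translates) GGGap-2 z<s i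

splitG : ∀ n μ → Parts GGap (suc n) μ →
  (Image (raise 1) (Parts GGGap (suc n)) ∪ Image (raiseWith 3 1) (Parts GGGap n)) μ
splitG n μ Pμ@(μ>0 , μR , len) with initLast μ
... | [] = contradiction len λ ()
... | ν ∷ʳ′ zero = contradiction (last-> ν μ>0) λ ()
-- The shift by 3 is composed of the shift by 1, which exchanges the relations, and the shift by 2,
-- which keeps parity.
... | ν ∷ʳ′ 1 = inj₂ (lowerWith-Parts (Translates-trans GGGap-GGap GGap-translates) GGap-1 ν Pμ)
... | ν ∷ʳ′ suc (suc s) = inj₁ (lower-Parts GGGap-GGap Pμ
  (All-above GGap⇒> ν μR (s≤s (s≤s z≤n))))

joinG : ∀ n μ → (Image (raise 1) (Parts GGGap (suc n)) ∪ Image (raiseWith 3 1) (Parts GGGap n)) μ →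
        Parts GGap (suc n) μ
joinG n μ (inj₁ i) = proj₁ (raise-Parts GGGap-GGap i)
joinG n μ (inj₂ i) = raiseWith-Parts (Translates-trans GGGap-GGap GGap-translates) GGap-1 z<s i

sum-raise-Parts : ∀ {R n} c d → c * n ≡ d → ∀ μ → Parts R n μ → sum (raise c μ) ≡ d + sum μ
sum-raise-Parts c d eq μ (_ , _ , ≡.refl) = ≡.trans (sum-raise c μ) (≡.cong (_+ sum μ) eq)

sum-raiseWith-Parts : ∀ {R n} c s d → c * n + s ≡ d →
                      ∀ μ → Parts R n μ → sum (raiseWith c s μ) ≡ d + sum μ
sum-raiseWith-Parts c s d eq μ (_ , _ , ≡.refl) =
  ≡.trans (sum-raiseWith c s μ) (≡.cong (_+ sum μ) eq)

raise-enumeration : ∀ {R n} c d → c * n ≡ d →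
                    Enumeration (Parts R n) → Enumeration (Image (raise c) (Parts R n))
raise-enumeration c d eq = image (raise c) (raise-injective c) d (sum-raise-Parts c d eq)

raiseWith-enumeration : ∀ {R n} c s d → c * n + s ≡ d →
                        Enumeration (Parts R n) → Enumeration (Image (raiseWith c s) (Parts R n))
raiseWith-enumeration c s d eq =
  image (raiseWith c s) (raiseWith-injective c s) d (sum-raiseWith-Parts c s d eq)

gf-raise : ∀ {R n} c d eq (e : Enumeration (Parts R n)) →
           gf (raise-enumeration c d eq e) ≈ q ^ˢ d *ˢ gf e
gf-raise c d eq = gf-image (raise c) (raise-injective c) d (sum-raise-Parts c d eq)

gf-raiseWith : ∀ {R n} c s d eq (e : Enumeration (Parts R n)) →
               gf (raiseWith-enumeration c s d eq e) ≈ q ^ˢ d *ˢ gf e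
gf-raiseWith c s d eq =
  gf-image (raiseWith c s) (raiseWith-injective c s) d (sum-raiseWith-Parts c s d eq)

-- On one side every part exceeds c; on the other the last part is s.
raise∩raiseWith : ∀ {Q R n m} c d s → s ≤ c →
                  ∀ μ → Image (raise c) (Parts Q n) μ → ¬ Image (raiseWith d s) (Parts R m) μ
raise∩raiseWith c d s s≤c μ (ν , (ν>0 , _) , ≡.refl) (ν′ , _ , eq) =
  ℕ.<⇒≱ (last-> (raise d ν′) (≡.subst (All (c <_)) eq (All-raise c ν ν>0))) s≤c

raiseWith∩raiseWith : ∀ {P Q c d s t} → s ≢ t →
                      ∀ μ → Image (raiseWith c s) P μ → ¬ Image (raiseWith d t) Q μ
raiseWith∩raiseWith {c = c} {d} s≢t μ (ν , _ , ≡.refl) (ν′ , _ , eq) =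
  s≢t (List.∷ʳ-injectiveʳ (raise c ν) (raise d ν′) eq)

gfGG gfG : ℕ → Series
gfGG n = gf (partitionsGG n)
gfG  n = gf (partitionsG n)

gfGG-suc : ∀ n → gfGG (suc n) ≈
  q ^ˢ (2 * n + 2) *ˢ gfGG (suc n) +ˢ (q ^ˢ (2 * n + 1) +ˢ q ^ˢ (4 * n + 2)) *ˢ gfGG n
gfGG-suc n = begin
  gfGG (suc n)
    ≈⟨ gf-cong (partitionsGG (suc n)) (union e₀ (union e₁ e₂ e₁∩e₂) e₀∩e₁₂) (splitGG n) (joinGG n) ⟩
  gf (union e₀ (union e₁ e₂ e₁∩e₂) e₀∩e₁₂)
    ≈⟨ gf-union e₀ (union e₁ e₂ e₁∩e₂) e₀∩e₁₂ ⟩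
  gf e₀ +ˢ gf (union e₁ e₂ e₁∩e₂)
    ≈⟨ ℤ[x,q].+-cong {gf e₀} {q ^ˢ (2 * n + 2) *ˢ gfGG (suc n)}
         {gf (union e₁ e₂ e₁∩e₂)} {(q ^ˢ (2 * n + 1) +ˢ q ^ˢ (4 * n + 2)) *ˢ gfGG n}
         (gf-raise 2 (2 * n + 2) (exponent n) (partitionsGG (suc n))) (begin
           gf (union e₁ e₂ e₁∩e₂)
             ≈⟨ gf-union e₁ e₂ e₁∩e₂ ⟩
           gf e₁ +ˢ gf e₂
             ≈⟨ ℤ[x,q].+-cong {gf e₁} {q ^ˢ (2 * n + 1) *ˢ gfGG n} {gf e₂} {q ^ˢ (4 * n + 2) *ˢ gfGG n}
                  (gf-raiseWith 2 1 (2 * n + 1) ≡.refl (partitionsGG n))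
                  (gf-raiseWith 4 2 (4 * n + 2) ≡.refl (partitionsGG n)) ⟩
           q ^ˢ (2 * n + 1) *ˢ gfGG n +ˢ q ^ˢ (4 * n + 2) *ˢ gfGG n
             ≈⟨ ℤ[x,q].distribʳ (gfGG n) (q ^ˢ (2 * n + 1)) (q ^ˢ (4 * n + 2)) ⟨
           (q ^ˢ (2 * n + 1) +ˢ q ^ˢ (4 * n + 2)) *ˢ gfGG n
             ∎) ⟩
  q ^ˢ (2 * n + 2) *ˢ gfGG (suc n) +ˢ (q ^ˢ (2 * n + 1) +ˢ q ^ˢ (4 * n + 2)) *ˢ gfGG n
    ∎
  where
  open SetoidReasoning ℤ[x,q].setoid
  exponent : ∀ n → 2 * suc n ≡ 2 * n + 2
  exponent = solve-∀
  e₀ = raise-enumeration 2 (2 * n + 2) (exponent n) (partitionsGG (suc n))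
  e₁ = raiseWith-enumeration 2 1 (2 * n + 1) ≡.refl (partitionsGG n)
  e₂ = raiseWith-enumeration 4 2 (4 * n + 2) ≡.refl (partitionsGG n)
  e₁∩e₂ = raiseWith∩raiseWith λ ()
  e₀∩e₁₂ = λ μ i → Sum.[ raise∩raiseWith 2 2 1 (s≤s z≤n) μ i , raise∩raiseWith 2 4 2 ℕ.≤-refl μ i ]

gfG-suc : ∀ n → gfG (suc n) ≈ q ^ˢ suc n *ˢ gfGG (suc n) +ˢ q ^ˢ (3 * n + 1) *ˢ gfGG n
gfG-suc n = begin
  gfG (suc n)
    ≈⟨ gf-cong (partitionsG (suc n)) (union e₀ e₁ e₀∩e₁) (splitG n) (joinG n) ⟩
  gf (union e₀ e₁ e₀∩e₁)
    ≈⟨ gf-union e₀ e₁ e₀∩e₁ ⟩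
  gf e₀ +ˢ gf e₁
    ≈⟨ ℤ[x,q].+-cong {gf e₀} {q ^ˢ suc n *ˢ gfGG (suc n)} {gf e₁} {q ^ˢ (3 * n + 1) *ˢ gfGG n}
         (gf-raise 1 (suc n) (ℕ.*-identityˡ (suc n)) (partitionsGG (suc n)))
         (gf-raiseWith 3 1 (3 * n + 1) ≡.refl (partitionsGG n)) ⟩
  q ^ˢ suc n *ˢ gfGG (suc n) +ˢ q ^ˢ (3 * n + 1) *ˢ gfGG n
    ∎
  where
  open SetoidReasoning ℤ[x,q].setoid
  e₀ = raise-enumeration 1 (suc n) (ℕ.*-identityˡ (suc n)) (partitionsGG (suc n))
  e₁ = raiseWith-enumeration 3 1 (3 * n + 1) ≡.refl (partitionsGG n)
  e₀∩e₁ = raise∩raiseWith 1 3 1 ℕ.≤-refl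

empty-enumeration : ∀ R → Enumeration (Parts R 0)
empty-enumeration R = record
  { list     = λ { zero → [ [] ] ; (suc _) → [] }
  ; unique   = λ { zero → [] ∷ [] ; (suc _) → [] }
  ; sound    = λ { {zero} (here ≡.refl) → ([] , [] , ≡.refl) , ≡.refl }
  ; complete = λ { {zero} {[]} _ _ → here ≡.refl }
  }

gf-zero : ∀ {R} (e : Enumeration (Parts R 0)) → gf e ≈ 1ˢ
gf-zero {R} e = begin
  gf e                      ≈⟨ gf-cong e (empty-enumeration R) (λ _ → id) (λ _ → id) ⟩
  gf (empty-enumeration R)  ≈⟨ (λ { zero _ → ≡.refl ; (suc _) _ → ≡.refl }) ⟩
  1ˢ                        ∎
  where open SetoidReasoning ℤ[x,q].setoid

-- Comparison of the two sides

module Recurrence = DoubleSumRecurrence seriesCommutativeRing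

-- Each use of z = q^c z raises the known order of vanishing by at least one.
fixed-order : ∀ c z → 0 < c → z ≈ q ^ˢ c *ˢ z → ∀ e → Order≥ e z
fixed-order c z 0<c z≈qz zero    = order-≥0 z
fixed-order c z 0<c z≈qz (suc e) n n<1+e i = ≡.trans (z≈qz n i)
  (order-* c e (q ^ˢ c) z (order-q^ c) (fixed-order c z 0<c z≈qz e) n
    (ℕ.<-≤-trans n<1+e (ℕ.+-monoˡ-≤ e 0<c)) i)

-- Once f n and g n agree, the difference at n + 1 is fixed by a positive power of q, hence vanishes
-- to every order.
recurrence-unique : ∀ (c : ℕ → ℕ) (w f g : ℕ → Series) → (∀ n → 0 < c n) → f 0 ≈ g 0 →
  (∀ n → f (suc n) ≈ q ^ˢ c n *ˢ f (suc n) +ˢ w n *ˢ f n) →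
  (∀ n → g (suc n) ≈ q ^ˢ c n *ˢ g (suc n) +ˢ w n *ˢ g n) →
  ∀ n → f n ≈ g n
recurrence-unique c w f g 0<c f₀≈g₀ f-suc g-suc zero    = f₀≈g₀
recurrence-unique c w f g 0<c f₀≈g₀ f-suc g-suc (suc n) =
  x∙y⁻¹≈ε⇒x≈y (f (suc n)) (g (suc n)) z≈0
  where
  open GroupProperties ℤ[x,q].+-group using (x∙y⁻¹≈ε⇒x≈y)
  open SetoidReasoning ℤ[x,q].setoid
  p = q ^ˢ c n
  f-suc′ : f (suc n) ≈ p *ˢ f (suc n) +ˢ w n *ˢ g n
  f-suc′ = begin
    f (suc n)                     ≈⟨ f-suc n ⟩
    p *ˢ f (suc n) +ˢ w n *ˢ f n  ≈⟨ ℤ[x,q].+-congˡ {p *ˢ f (suc n)} {w n *ˢ f n} {w n *ˢ g n}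
                                      (ℤ[x,q].*-congˡ {w n} {f n} {g n}
                                        (recurrence-unique c w f g 0<c f₀≈g₀ f-suc g-suc n)) ⟩
    p *ˢ f (suc n) +ˢ w n *ˢ g n  ∎
  z = f (suc n) -ˢ g (suc n)
  z-order : ∀ e → Order≥ e z
  z-order = fixed-order (c n) z (0<c n)
    (Recurrence.difference-fixed {f (suc n)} {g (suc n)} {p} {w n *ˢ g n} f-suc′ (g-suc n))
  z≈0 : z ≈ 0ˢ
  z≈0 zero    = z-order 1 0 ℕ.≤-refl
  z≈0 (suc i) = z-order (2 + i) (suc i) ℕ.≤-refl

-- Reciprocals and q-Pochhammer symbols

recip-tail : ∀ (f g : Series) n →
  sumᵖ (Vec.toList (Vec.zipWith _*ᵖ_ (Vec.tabulate (f ∘ toℕ)) (recipCoeffs g n)))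
    ≈ᵖ (f ℤ[x]⟦q⟧.⋆ recip g) n
recip-tail f g zero    = ℤ[x].+-identityʳ (f 0 *ᵖ 1ᵖ)
recip-tail f g (suc n) = ℤ[x].+-congˡ {f 0 *ᵖ recip g (suc n)} (recip-tail (f ∘ suc) g n)

-- By `recip-tail` the sum in `recipCoeffs` is a Cauchy product with the tail of g, the vector being
-- stored in descending order. As g has constant term 1, each new coefficient cancels that sum.
recip-inverse : ∀ g → g 0 ≈ᵖ 1ᵖ → g *ˢ recip g ≈ 1ˢ
recip-inverse g g₀≈1 zero = begin
  (g *ˢ recip g) 0   ≈⟨ *ˢ≈⋆ g (recip g) 0 ⟩
  g 0 *ᵖ 1ᵖ          ≈⟨ ℤ[x].*-identityʳ (g 0) ⟩
  g 0                ≈⟨ g₀≈1 ⟩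
  1ᵖ                 ∎
  where open SetoidReasoning ℤ[x].setoid
recip-inverse g g₀≈1 (suc n) = begin
  (g *ˢ recip g) (suc n)
    ≈⟨ *ˢ≈⋆ g (recip g) (suc n) ⟩
  g 0 *ᵖ (-ᵖ t) +ᵖ s
    ≈⟨ ℤ[x].+-cong {g 0 *ᵖ (-ᵖ t)} {1ᵖ *ᵖ (-ᵖ t)} {s} {t}
         (ℤ[x].*-congʳ { -ᵖ t} {g 0} {1ᵖ} g₀≈1) (ℤ[x].sym {t} {s} (recip-tail (g ∘ suc) g n)) ⟩
  1ᵖ *ᵖ (-ᵖ t) +ᵖ t
    ≈⟨ ℤ[x].+-congʳ {t} {1ᵖ *ᵖ (-ᵖ t)} { -ᵖ t} (ℤ[x].*-identityˡ (-ᵖ t)) ⟩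
  -ᵖ t +ᵖ t
    ≈⟨ ℤ[x].-‿inverseˡ t ⟩
  0ᵖ
    ∎
  where
  open SetoidReasoning ℤ[x].setoid
  t = sumᵖ (Vec.toList (Vec.zipWith _*ᵖ_ (Vec.tabulate (g ∘ suc ∘ toℕ)) (recipCoeffs g n)))
  s = (g ∘ suc ℤ[x]⟦q⟧.⋆ recip g) n

qPochhammer-constant : ∀ f g n → f 0 ≈ᵖ 0ᵖ → qPochhammer f g n 0 ≈ᵖ 1ᵖ
qPochhammer-constant f g zero    f₀≈0 = ℤ[x].refl {1ᵖ}
qPochhammer-constant f g (suc n) f₀≈0 = begin
  (P *ˢ (1ˢ -ˢ f *ˢ g ^ˢ n)) 0
    ≈⟨ *ˢ≈⋆ P (1ˢ -ˢ f *ˢ g ^ˢ n) 0 ⟩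
  P 0 *ᵖ (1ᵖ +ᵖ -ᵖ (f *ˢ g ^ˢ n) 0)
    ≈⟨ ℤ[x].*-cong {P 0} {1ᵖ} {1ᵖ +ᵖ -ᵖ (f *ˢ g ^ˢ n) 0} {1ᵖ}
         (qPochhammer-constant f g n f₀≈0)
         (begin
           1ᵖ +ᵖ -ᵖ (f *ˢ g ^ˢ n) 0  ≈⟨ ℤ[x].+-congˡ {1ᵖ} { -ᵖ (f *ˢ g ^ˢ n) 0} {0ᵖ}
                                          (ℤ[x].-‿cong {(f *ˢ g ^ˢ n) 0} {0ᵖ} fg₀≈0) ⟩
           1ᵖ                        ∎) ⟩
  1ᵖ *ᵖ 1ᵖ
    ≈⟨ ℤ[x].*-identityˡ 1ᵖ ⟩
  1ᵖ
    ∎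
  where
  open SetoidReasoning ℤ[x].setoid
  P = qPochhammer f g n
  fg₀≈0 : (f *ˢ g ^ˢ n) 0 ≈ᵖ 0ᵖ
  fg₀≈0 = begin
    (f *ˢ g ^ˢ n) 0     ≈⟨ *ˢ≈⋆ f (g ^ˢ n) 0 ⟩
    f 0 *ᵖ (g ^ˢ n) 0   ≈⟨ *-zeroˡ (f 0) ((g ^ˢ n) 0) f₀≈0 ⟩
    0ᵖ                  ∎

recip₁ recip₄ : ℕ → Series
recip₁ m = recip (qPochhammer q q m)
recip₄ k = recip (qPochhammer (q ^ˢ 4) (q ^ˢ 4) k)

q^4-constant : (q ^ˢ 4) 0 ≈ᵖ 0ᵖ
q^4-constant = order-q^ 4 0 (s≤s z≤n)

recip₁-inverse : ∀ m → qPochhammer q q m *ˢ recip₁ m ≈ 1ˢ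
recip₁-inverse m = recip-inverse (qPochhammer q q m) (qPochhammer-constant q q m (λ _ → ≡.refl))

recip₄-inverse : ∀ k → qPochhammer (q ^ˢ 4) (q ^ˢ 4) k *ˢ recip₄ k ≈ 1ˢ
recip₄-inverse k = recip-inverse (qPochhammer (q ^ˢ 4) (q ^ˢ 4) k)
  (qPochhammer-constant (q ^ˢ 4) (q ^ˢ 4) k q^4-constant)

recip₁-suc : ∀ m → recip₁ (suc m) ≈ recip₁ m +ˢ q ^ˢ suc m *ˢ recip₁ (suc m)
recip₁-suc m = Recurrence.inverse-step {qPochhammer q q m} {recip₁ m} {recip₁ (suc m)} {q ^ˢ suc m}
  (recip₁-inverse m) (recip₁-inverse (suc m))

recip₄-suc : ∀ k → recip₄ (suc k) ≈ recip₄ k +ˢ (q ^ˢ 4) ^ˢ suc k *ˢ recip₄ (suc k)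
recip₄-suc k = Recurrence.inverse-step
  {qPochhammer (q ^ˢ 4) (q ^ˢ 4) k} {recip₄ k} {recip₄ (suc k)} {(q ^ˢ 4) ^ˢ suc k}
  (recip₄-inverse k) (recip₄-inverse (suc k))

recip₁-zero : recip₁ 0 ≈ 1ˢ
recip₁-zero = begin
  recip₁ 0        ≈⟨ ℤ[x,q].*-identityˡ (recip₁ 0) ⟨
  1ˢ *ˢ recip₁ 0  ≈⟨ recip₁-inverse 0 ⟩
  1ˢ              ∎
  where open SetoidReasoning ℤ[x,q].setoid

recip₄-zero : recip₄ 0 ≈ 1ˢ
recip₄-zero = begin
  recip₄ 0        ≈⟨ ℤ[x,q].*-identityˡ (recip₄ 0) ⟨
  1ˢ *ˢ recip₄ 0  ≈⟨ recip₄-inverse 0 ⟩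
  1ˢ              ∎
  where open SetoidReasoning ℤ[x,q].setoid

module ∑ˢ = DiagonalSums ℤ[x,q].commutativeSemiring

term : (ℕ → ℕ → ℕ) → ℕ × ℕ → Series
term = Recurrence.term q recip₁ recip₄ recip₁-zero recip₄-zero recip₁-suc recip₄-suc

diagonalSum-GG-suc : ∀ n → ∑ˢ.diagonalSum (term exponentGG) (suc n) ≈
  q ^ˢ (2 * n + 2) *ˢ ∑ˢ.diagonalSum (term exponentGG) (suc n)
    +ˢ (q ^ˢ (2 * n + 1) +ˢ q ^ˢ (4 * n + 2)) *ˢ ∑ˢ.diagonalSum (term exponentGG) n
diagonalSum-GG-suc =
  Recurrence.diagonalSum-GG-suc q recip₁ recip₄ recip₁-zero recip₄-zero recip₁-suc recip₄-suc

diagonalSum-zero : ∀ e → e 0 0 ≡ 0 → ∑ˢ.diagonalSum (term e) 0 ≈ 1ˢ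
diagonalSum-zero =
  Recurrence.diagonalSum-zero q recip₁ recip₄ recip₁-zero recip₄-zero recip₁-suc recip₄-suc

gf≈diagonalSum-zero : ∀ {R} (f : Enumeration (Parts R 0)) e → e 0 0 ≡ 0 →
                      gf f ≈ ∑ˢ.diagonalSum (term e) 0
gf≈diagonalSum-zero f e e₀₀ = begin
  gf f             ≈⟨ gf-zero f ⟩
  1ˢ               ≈⟨ diagonalSum-zero e e₀₀ ⟨
  ∑ˢ.diagonalSum (term e) 0  ∎
  where open SetoidReasoning ℤ[x,q].setoid

gfGG≈diagonalSum : ∀ n → gfGG n ≈ ∑ˢ.diagonalSum (term exponentGG) n
gfGG≈diagonalSum = recurrence-unique (λ n → 2 * n + 2) (λ n → q ^ˢ (2 * n + 1) +ˢ q ^ˢ (4 * n + 2))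
  gfGG (∑ˢ.diagonalSum (term exponentGG)) (λ n → ℕ.<-≤-trans z<s (ℕ.m≤n+m 2 (2 * n)))
  (gf≈diagonalSum-zero (partitionsGG 0) exponentGG ≡.refl) gfGG-suc diagonalSum-GG-suc

gfG≈diagonalSum : ∀ n → gfG n ≈ ∑ˢ.diagonalSum (term exponentG) n
gfG≈diagonalSum zero    = gf≈diagonalSum-zero (partitionsG 0) exponentG ≡.refl
gfG≈diagonalSum (suc n) = begin
  gfG (suc n)
    ≈⟨ gfG-suc n ⟩
  q ^ˢ suc n *ˢ gfGG (suc n) +ˢ q ^ˢ (3 * n + 1) *ˢ gfGG n
    ≈⟨ ℤ[x,q].+-cong {q ^ˢ suc n *ˢ gfGG (suc n)} {q ^ˢ suc n *ˢ ∑ˢ.diagonalSum (term exponentGG) (suc n)}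
         {q ^ˢ (3 * n + 1) *ˢ gfGG n} {q ^ˢ (3 * n + 1) *ˢ ∑ˢ.diagonalSum (term exponentGG) n}
         (ℤ[x,q].*-congˡ {q ^ˢ suc n} {gfGG (suc n)} {∑ˢ.diagonalSum (term exponentGG) (suc n)}
           (gfGG≈diagonalSum (suc n)))
         (ℤ[x,q].*-congˡ {q ^ˢ (3 * n + 1)} {gfGG n} {∑ˢ.diagonalSum (term exponentGG) n}
           (gfGG≈diagonalSum n)) ⟩
  q ^ˢ suc n *ˢ ∑ˢ.diagonalSum (term exponentGG) (suc n) +ˢ q ^ˢ (3 * n + 1) *ˢ ∑ˢ.diagonalSum (term exponentGG) n
    ≈⟨ Recurrence.diagonalSum-G-suc q recip₁ recip₄ recip₁-zero recip₄-zero recip₁-suc recip₄-suc n ⟨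
  ∑ˢ.diagonalSum (term exponentG) (suc n)
    ∎
  where open SetoidReasoning ℤ[x,q].setoid

-- Powers of x and q in the summands

open Exponentiation ℤ[x].semiring using () renaming (_^_ to infixr 8 _^ᵖ_)

X : Poly
X = x 0

x*-coeff : ∀ f n → (x *ˢ f) n ≈ᵖ X *ᵖ f n
x*-coeff f n = begin
  (x *ˢ f) n         ≈⟨ *ˢ≈⋆ x f n ⟩
  (x ℤ[x]⟦q⟧.⋆ f) n  ≈⟨ ℤ[x]⟦q⟧.⋆-constantˡ X x f (ℤ[x].refl {X}) (λ _ → ℤ[x].refl {0ᵖ}) n ⟩
  X *ᵖ f n           ∎
  where open SetoidReasoning ℤ[x].setoid

x^*-coeff : ∀ l f n → (x ^ˢ l *ˢ f) n ≈ᵖ X ^ᵖ l *ᵖ f n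
x^*-coeff zero    f n = begin
  (1ˢ *ˢ f) n    ≈⟨ ℤ[x,q].*-identityˡ f n ⟩
  f n            ≈⟨ ℤ[x].*-identityˡ (f n) ⟨
  1ᵖ *ᵖ f n      ∎
  where open SetoidReasoning ℤ[x].setoid
x^*-coeff (suc l) f n = begin
  (x ^ˢ suc l *ˢ f) n          ≈⟨ ℤ[x,q].*-assoc x (x ^ˢ l) f n ⟩
  (x *ˢ (x ^ˢ l *ˢ f)) n       ≈⟨ x*-coeff (x ^ˢ l *ˢ f) n ⟩
  X *ᵖ (x ^ˢ l *ˢ f) n         ≈⟨ ℤ[x].*-congˡ {X} {(x ^ˢ l *ˢ f) n} {X ^ᵖ l *ᵖ f n} (x^*-coeff l f n) ⟩
  X *ᵖ (X ^ᵖ l *ᵖ f n)         ≈⟨ ℤ[x].*-assoc X (X ^ᵖ l) (f n) ⟨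
  X ^ᵖ suc l *ᵖ f n            ∎
  where open SetoidReasoning ℤ[x].setoid

q^-coeff-≡ : ∀ s → (q ^ˢ s) s ≈ᵖ 1ᵖ
q^-coeff-≡ zero    = ℤ[x].refl {1ᵖ}
q^-coeff-≡ (suc s) = ℤ[x].trans {(q ^ˢ suc s) (suc s)} {(q ^ˢ s) s} {1ᵖ}
  (q*-suc (q ^ˢ s) s) (q^-coeff-≡ s)

q^-coeff-≢ : ∀ s n → s ≢ n → (q ^ˢ s) n ≈ᵖ 0ᵖ
q^-coeff-≢ zero    zero    s≢n = contradiction ≡.refl s≢n
q^-coeff-≢ zero    (suc n) s≢n = ℤ[x].refl {0ᵖ}
q^-coeff-≢ (suc s) zero    s≢n = q*-zero (q ^ˢ s)
q^-coeff-≢ (suc s) (suc n) s≢n = ℤ[x].trans {(q ^ˢ suc s) (suc n)} {(q ^ˢ s) n} {0ᵖ}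
  (q*-suc (q ^ˢ s) n) (q^-coeff-≢ s n (s≢n ∘ ≡.cong suc))

weight-≡ : ∀ μ → weight μ (sum μ) ≈ᵖ X ^ᵖ length μ *ᵖ 1ᵖ
weight-≡ μ = begin
  weight μ (sum μ)                             ≈⟨ x^*-coeff (length μ) (q ^ˢ sum μ) (sum μ) ⟩
  X ^ᵖ length μ *ᵖ (q ^ˢ sum μ) (sum μ)        ≈⟨ ℤ[x].*-congˡ {X ^ᵖ length μ}
                                                    {(q ^ˢ sum μ) (sum μ)} {1ᵖ} (q^-coeff-≡ (sum μ)) ⟩
  X ^ᵖ length μ *ᵖ 1ᵖ                          ∎
  where open SetoidReasoning ℤ[x].setoid

weight-≢ : ∀ μ n → sum μ ≢ n → weight μ n ≈ᵖ 0ᵖ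
weight-≢ μ n s≢n = begin
  weight μ n                         ≈⟨ x^*-coeff (length μ) (q ^ˢ sum μ) n ⟩
  X ^ᵖ length μ *ᵖ (q ^ˢ sum μ) n    ≈⟨ *-zeroʳ (X ^ᵖ length μ) ((q ^ˢ sum μ) n) (q^-coeff-≢ (sum μ) n s≢n) ⟩
  0ᵖ                                 ∎
  where open SetoidReasoning ℤ[x].setoid

⨁-coeff : ∀ {I : Set} (S : List I) (F : I → Series) n → ∑ˢ.⨁ S F n ≈ᵖ ∑ᵖ.⨁ S (λ i → F i n)
⨁-coeff []      F zero    = ℤ[x].refl {0ᵖ}
⨁-coeff []      F (suc n) = ℤ[x].refl {0ᵖ}
⨁-coeff (i ∷ S) F n       = ℤ[x].+-congˡ {F i n} {∑ˢ.⨁ S F n} (⨁-coeff S F n)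

-- The power of x depends on m + 2k alone and is set apart; the reciprocal of the product of
-- q-Pochhammer symbols splits by uniqueness of inverses.
doubleSumTerm-factor : ∀ e k m → doubleSumTerm e (k , m) ≈ x ^ˢ (m + 2 * k) *ˢ term e (k , m)
doubleSumTerm-factor e k m = Recurrence.pull-out ((-ˢ 1ˢ) ^ˢ k) (x ^ˢ (m + 2 * k)) (q ^ˢ e k m)
  {recip (P *ˢ Q)} {recip₁ m *ˢ recip₄ k}
  (Recurrence.inverse-* {P} {recip₁ m} {Q} {recip₄ k} {recip (P *ˢ Q)} (recip₁-inverse m) (recip₄-inverse k)
    (recip-inverse (P *ˢ Q) (begin
      (P *ˢ Q) 0    ≈⟨ *ˢ≈⋆ P Q 0 ⟩
      P 0 *ᵖ Q 0    ≈⟨ ℤ[x].*-cong {P 0} {1ᵖ} {Q 0} {1ᵖ} (qPochhammer-constant q q m (λ _ → ≡.refl))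
                         (qPochhammer-constant (q ^ˢ 4) (q ^ˢ 4) k q^4-constant) ⟩
      1ᵖ *ᵖ 1ᵖ      ≈⟨ ℤ[x].*-identityˡ 1ᵖ ⟩
      1ᵖ            ∎)))
  where
  open SetoidReasoning ℤ[x].setoid
  P = qPochhammer q q m
  Q = qPochhammer (q ^ˢ 4) (q ^ˢ 4) k

-- Grouping both sums by the power of x

module _ {R : Rel ℕ 0ℓ} (R-trans : Transitive R) (R⇒> : ∀ {a b} → R a b → b < a)
  (s : Summable (Separated R) weight) (enum : ∀ n → Enumeration (Parts R n))
  where

  -- The support and the enumeration may differ: a listed partition whose sum is not N has zero
  -- weight at q^N, and an enumerated one missing from the support vanishes there by completeness.
  weights-of-length : ∀ n N →
    ∑ᵖ.⨁ (filter (λ μ → length μ ℕ.≟ n) (Summable.support s N)) (λ μ → weight μ N)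
      ≈ᵖ (x ^ˢ n *ˢ gf (enum n)) N
  weights-of-length n N = begin
    ∑ᵖ.⨁ (filter (λ μ → length μ ℕ.≟ n) S) (λ μ → weight μ N)
      ≈⟨ ∑ᵖ.⨁-support (List.≡-dec ℕ._≟_) {filter (λ μ → length μ ℕ.≟ n) S} {list (enum n) N} (λ μ → weight μ N)
           (Unique.filter⁺ (λ μ → length μ ℕ.≟ n) (Summable.unique s N)) (unique (enum n) N)
           (λ μ μ∈ μ∉ → let μ∈S , len = ∈-filter⁻ (λ μ → length μ ℕ.≟ n) μ∈ in
              weight-≢ μ N λ eq → μ∉ (complete (enum n)
                (Separated⇒Parts R-trans R⇒> (All.lookup (Summable.sound s N) μ∈S) len) eq))
           (λ μ μ∈ μ∉ → let Pμ@(_ , _ , len) , eq = sound (enum n) μ∈ in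
              Summable.complete s N μ (Parts⇒Separated R-trans R⇒> Pμ) λ μ∈S →
                μ∉ (∈-filter⁺ (λ μ → length μ ℕ.≟ n) μ∈S len)) ⟩
    ∑ᵖ.⨁ (list (enum n) N) (λ μ → weight μ N)
      ≈⟨ ∑ᵖ.⨁-cong (list (enum n) N) {λ μ → weight μ N} {λ _ → X ^ᵖ n *ᵖ 1ᵖ}
           (λ μ μ∈ → let (_ , _ , len) , eq = sound (enum n) μ∈ in weight-of μ eq len) ⟩
    ∑ᵖ.⨁ (list (enum n) N) (λ _ → X ^ᵖ n *ᵖ 1ᵖ)
      ≈⟨ Poly⨁.⨁-scale (X ^ᵖ n) (list (enum n) N) (λ _ → 1ᵖ) ⟩
    X ^ᵖ n *ᵖ gf (enum n) N
      ≈⟨ x^*-coeff n (gf (enum n)) N ⟨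
    (x ^ˢ n *ˢ gf (enum n)) N
      ∎
    where
    open SetoidReasoning ℤ[x].setoid
    module Poly⨁ = DiagonalSums ℤ[x].commutativeSemiring
    S = Summable.support s N
    weight-of : ∀ μ → sum μ ≡ N → length μ ≡ n → weight μ N ≈ᵖ X ^ᵖ n *ᵖ 1ᵖ
    weight-of μ ≡.refl ≡.refl = weight-≡ μ

module _ (e : ℕ → ℕ → ℕ) (s : Summable U (doubleSumTerm e)) where

  terms-of-degree : ∀ n N →
    ∑ᵖ.⨁ (filter (λ (k , m) → m + 2 * k ℕ.≟ n) (Summable.support s N)) (λ i → doubleSumTerm e i N)
      ≈ᵖ (x ^ˢ n *ˢ ∑ˢ.diagonalSum (term e) n) N
  terms-of-degree n N = begin
    ∑ᵖ.⨁ (filter degree? S) (λ i → doubleSumTerm e i N)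
      ≈⟨ ∑ᵖ.⨁-support (≡-dec ℕ._≟_ ℕ._≟_) {filter degree? S} {antidiagonal n} (λ i → doubleSumTerm e i N)
           (Unique.filter⁺ degree? (Summable.unique s N)) (antidiagonal-unique n)
           -- The antidiagonal contains every pair of degree n, so nothing in the filtered support
           -- lies outside it.
           (λ (k , m) i∈ i∉ → contradiction
             (≡.subst (λ n → (k , m) ∈ antidiagonal n) (proj₂ (∈-filter⁻ degree? {xs = S} i∈))
               (∈-antidiagonal⁺ k m)) i∉)
           (λ i i∈ i∉ → Summable.complete s N i _ λ i∈S →
             i∉ (∈-filter⁺ degree? i∈S (∈-antidiagonal⁻ n i∈))) ⟩
    ∑ᵖ.⨁ (antidiagonal n) (λ i → doubleSumTerm e i N)
      ≈⟨ ∑ᵖ.⨁-cong (antidiagonal n) {λ i → doubleSumTerm e i N} {λ i → (x ^ˢ n *ˢ term e i) N}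
           (λ (k , m) i∈ → factor k m (∈-antidiagonal⁻ n i∈)) ⟩
    ∑ᵖ.⨁ (antidiagonal n) (λ i → (x ^ˢ n *ˢ term e i) N)
      ≈⟨ ⨁-coeff (antidiagonal n) (λ i → x ^ˢ n *ˢ term e i) N ⟨
    ∑ˢ.⨁ (antidiagonal n) (λ i → x ^ˢ n *ˢ term e i) N
      ≈⟨ ∑ˢ.⨁-scale (x ^ˢ n) (antidiagonal n) (term e) N ⟩
    (x ^ˢ n *ˢ ∑ˢ.diagonalSum (term e) n) N
      ∎
    where
    open SetoidReasoning ℤ[x].setoid
    S = Summable.support s N
    degree? = λ ((k , m) : ℕ × ℕ) → m + 2 * k ℕ.≟ n
    factor : ∀ k m → m + 2 * k ≡ n → doubleSumTerm e (k , m) N ≈ᵖ (x ^ˢ n *ˢ term e (k , m)) N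
    factor k m ≡.refl = doubleSumTerm-factor e k m N

∑-fibres : ∀ {I} {P : Pred I 0ℓ} {F} (f : I → ℕ) (s : Summable P F) N B →
  (∀ i → i ∈ Summable.support s N → f i < B) →
  ∑ᵖ.⨁ (upTo B) (λ n → ∑ᵖ.⨁ (filter (λ i → f i ℕ.≟ n) (Summable.support s N)) (λ i → F i N)) ≈ᵖ ∑ P F s N
∑-fibres {F = F} f s N B f<B = ∑ᵖ.⨁-fibres f B (Summable.support s N) (λ i → F i N)
  λ i i∈ B≤fi → contradiction B≤fi (ℕ.<⇒≱ (f<B i i∈))

∑-weight≈doubleSum : ∀ {R} → Transitive R → (∀ {a b} → R a b → b < a) →
  ∀ (s : Summable (Separated R) weight) (enum : ∀ n → Enumeration (Parts R n))
  e (t : Summable U (doubleSumTerm e)) → (∀ n → gf (enum n) ≈ ∑ˢ.diagonalSum (term e) n) →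
  ∑ (Separated R) weight s ≈ ∑ U (doubleSumTerm e) t
∑-weight≈doubleSum {R} R-trans R⇒> s enum e t gf≈diagonalSum N = begin
  ∑ (Separated R) weight s N
    ≈⟨ ∑-fibres length s N B (λ μ μ∈ → bounded (∈-++⁺ˡ (∈-map⁺ length μ∈))) ⟨
  ∑ᵖ.⨁ (upTo B) (λ n → ∑ᵖ.⨁ (filter (λ μ → length μ ℕ.≟ n) S) (λ μ → weight μ N))
    ≈⟨ ∑ᵖ.⨁-cong (upTo B)
         {λ n → ∑ᵖ.⨁ (filter (λ μ → length μ ℕ.≟ n) S) (λ μ → weight μ N)}
         {λ n → ∑ᵖ.⨁ (filter (λ i → degree i ℕ.≟ n) T) (λ i → doubleSumTerm e i N)}
         (λ n _ → fibre n) ⟩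
  ∑ᵖ.⨁ (upTo B) (λ n → ∑ᵖ.⨁ (filter (λ i → degree i ℕ.≟ n) T) (λ i → doubleSumTerm e i N))
    ≈⟨ ∑-fibres degree t N B (λ i i∈ → bounded (∈-++⁺ʳ (map length S) (∈-map⁺ degree i∈))) ⟩
  ∑ U (doubleSumTerm e) t N
    ∎
  where
  open SetoidReasoning ℤ[x].setoid
  S = Summable.support s N
  T = Summable.support t N
  degree : ℕ × ℕ → ℕ
  degree (k , m) = m + 2 * k
  sizes = map length S ++ map degree T
  -- A bound above every exponent of x that occurs in either support, so that no fibre is lost.
  B = suc (max 0 sizes)
  bounded : ∀ {l} → l ∈ sizes → l < B
  bounded l∈ = s≤s (All.lookup (xs≤max 0 sizes) l∈)
  fibre : ∀ n → ∑ᵖ.⨁ (filter (λ μ → length μ ℕ.≟ n) S) (λ μ → weight μ N)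
             ≈ᵖ ∑ᵖ.⨁ (filter (λ i → degree i ℕ.≟ n) T) (λ i → doubleSumTerm e i N)
  fibre n = begin
    ∑ᵖ.⨁ (filter (λ μ → length μ ℕ.≟ n) S) (λ μ → weight μ N)
      ≈⟨ weights-of-length R-trans R⇒> s enum n N ⟩
    (x ^ˢ n *ˢ gf (enum n)) N
      ≈⟨ ℤ[x,q].*-congˡ {x ^ˢ n} {gf (enum n)} {∑ˢ.diagonalSum (term e) n} (gf≈diagonalSum n) N ⟩
    (x ^ˢ n *ˢ ∑ˢ.diagonalSum (term e) n) N
      ≈⟨ terms-of-degree e t n N ⟨
    ∑ᵖ.⨁ (filter (λ i → degree i ℕ.≟ n) T) (λ i → doubleSumTerm e i N)
      ∎

theorem1p2 : (fGG ≈ ∑ {ℕ × ℕ} U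
    (λ (k , m) → ((-ˢ 1ˢ) ^ˢ k *ˢ x ^ˢ (m + 2 * k) *ˢ q ^ˢ (m ^ 2 + 4 * m * k + 6 * k ^ 2))
    /ˢ (qPochhammer q q m *ˢ qPochhammer (q ^ˢ 4) (q ^ˢ 4) k))
    doubleSumGG-summable)
    ×
    (fG ≈ ∑ {ℕ × ℕ} U
    (λ (k , m) → ((-ˢ 1ˢ) ^ˢ k *ˢ x ^ˢ (m + 2 * k) *ˢ q ^ˢ (m ^ 2 + 4 * m * k + 6 * k ^ 2 ∸ 2 * k))
    /ˢ (qPochhammer q q m *ˢ qPochhammer (q ^ˢ 4) (q ^ˢ 4) k))
    doubleSumG-summable)
theorem1p2 =
  -- `GöllnitzGordon` unfolds to `Separated GGGap`, and the displayed summand is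
  -- `doubleSumTerm exponentGG`; likewise for the second identity.
  ∑-weight≈doubleSum GGGap-trans GGGap⇒> GöllnitzGordon-summable partitionsGG
    exponentGG doubleSumGG-summable gfGG≈diagonalSum
  ,
  ∑-weight≈doubleSum GGap-trans GGap⇒> Göllnitz-summable partitionsG
    exponentG doubleSumG-summable gfG≈diagonalSum
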